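{- No order-unaware algorithm has order-competitive ratio strictly better than $\frac{11}{12}$ on the class $\mathcal C$ of (asymptotic) instances satisfying assumptions (1)–(5) of the context. That is, for every (possibly randomized) order-unaware algorithm and every $c>\frac{11}{12}$ there is an asymptotic instance $(I_k)_{k\ge1}\in\mathcal C$ with $\liminf_{k\to\infty} \mathrm{ALG}(I_k)/\mathrm{OPT_{online}}(I_k)<c$.
   Context: Problem. An instance $I$ consists of a finite edge-weighted bipartite graph $(U\cup V,E,w)$ with weights $w_{it}\ge0$, probabilities $p\in[0,1]^V$, and an arrival order of $V$. Online vertices $t\in V$ arrive in this order; upon arrival the identity of $t$ and whether it is realized are observed ($t$ is realized independently with probability $p_t$). If realized, $t$ may be immediately and irrevocably matched to a currently unmatched neighbour $i\in U$, collecting $w_{it}$; each vertex is matched at most once. An order-unaware algorithm knows $U,V,E,w,p$ in advance but not the arrival order; $\mathrm{ALG}(I)$ is its expected reward. $\mathrm{OPT_{online}}(I)$ is the maximum expected reward of an online algorithm that also knows the arrival order. $\mathrm{LP_{ex\text{ - }ante}}(I)=\max\{\sum_{(i,t)\in E} w_{it}x_{it}: x\ge0,\ \sum_i x_{it}\le p_t\ \forall t\in V,\ \sum_t x_{it}\le 1\ \forall i\in U\}$. The class $\mathcal C$. An asymptotic instance is a sequence $(I_k)_{k\ge1}$ of instances with the same graph $(U\cup V,E)$ and arrival order, a fixed partition of $V$ into deterministic vertices $D$ and free vertices $F$, and fixed values $v_t\geq 0$ ($t\in V$), such that: (1) in every $I_k$, $p_t=1$ for $t\in D$, and $p_t=p_t^{(k)}\in(0,1]$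 with $p_t^{(k)}\to0$ as $k\to\infty$ for $t\in F$; (2) weights are online-vertex weights: $w_{it}=w_t$ for every $(i,t)\in E$, with $w_t p_t=v_t$ in every $I_k$, and every online vertex has at least one neighbour; (3) $\lim_{k}\mathrm{OPT_{online}}(I_k)=\lim_k \mathrm{LP_{ex\text{ - }ante}}(I_k)$; (4) (Balancedness) letting $M^*$ be a maximum-weight matching between $U$ and $D$, and $w_i$ the weight of the edge of $M^*$ at $i\in U$ ($w_i=0$ if $i$ is unmatched), one has $w_i=v_i$ for every $i\in U$, where $v_i=\sum_{t\in F:\,(i,t)\in E}v_t$; (5) (Uniqueness) every free vertex has exactly one neighbour. -}

module Defs where

open import Algebra.Bundles using (CommutativeRing)
open import Data.Bool.Base using (Bool; true; false; if_then_else_; _∧_; T)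
open import Data.Fin.Base using (Fin)
open import Data.Fin.Permutation using (Permutation′; _⟨$⟩ʳ_)
open import Data.List.Base using (List; []; _∷_; map; allFin)
open import Data.List.Relation.Unary.Any using (Any)
open import Data.Maybe.Base using (Maybe; just; nothing; maybe′)
open import Data.Nat.Base as ℕ using (ℕ)
open import Data.Product.Base using (∃; ∃-syntax; _×_)
open import Level using (0ℓ; suc)
open import Relation.Binary.Core using (Rel)
open import Relation.Binary.Structures using (IsTotalOrder)
open import Relation.Binary.PropositionalEquality.Core using (_≡_)
open import Relation.Nullary using (¬_)

import Algebra.Definitions.RawMonoid as RawMonoidOps
import Algebra.Properties.Monoid.Sum as MonoidSum
import Relation.Binary.Construct.NonStrictToStrict as Strict

module Bounds {A : Set} (_≤_ : Rel A 0ℓ) where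

  UpperBound LowerBound : (A → Set) → A → Set
  UpperBound S b = ∀ x → S x → x ≤ b
  LowerBound S b = ∀ x → S x → b ≤ x

  IsSup IsInf IsMaximum : (A → Set) → A → Set
  IsSup S s     = UpperBound S s × (∀ b → UpperBound S b → s ≤ b)
  IsInf S s     = LowerBound S s × (∀ b → LowerBound S b → b ≤ s)
  IsMaximum S s = S s × UpperBound S s

-- The real numbers, characterised up to isomorphism as a Dedekind-complete
-- ordered field.  Equality is the setoid equality of the underlying ring.
-- The value of x ⁻¹ at x ≈ 0# is unspecified.

record CompleteOrderedField : Set (suc 0ℓ) where
  infix  4 _≤_
  infix  8 _⁻¹
  field
    commutativeRing : CommutativeRing 0ℓ 0ℓ

  open CommutativeRing commutativeRing public

  field
    _≤_          : Rel Carrier 0ℓ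
    _⁻¹          : Carrier → Carrier
    isTotalOrder : IsTotalOrder _≈_ _≤_
    0≉1          : ¬ (0# ≈ 1#)
    ⁻¹-inverseʳ  : ∀ x → ¬ (x ≈ 0#) → x * x ⁻¹ ≈ 1#
    +-monoˡ-≤    : ∀ z {x y} → x ≤ y → x + z ≤ y + z
    *-nonneg     : ∀ {x y} → 0# ≤ x → 0# ≤ y → 0# ≤ x * y

  open Bounds _≤_ public

  field
    complete : ∀ (S : Carrier → Set) → ∃ S → ∃ (UpperBound S) → ∃ (IsSup S)

  open Strict _≈_ _≤_ public using (_<_)
  open MonoidSum +-monoid public using (sum)

  infix  4 _⟶_
  infixl 7 _/_

  _/_ : Carrier → Carrier → Carrier
  x / y = x * y ⁻¹

  fromℕ : ℕ → Carrier
  fromℕ n = RawMonoidOps._×_ +-rawMonoid n 1#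

  _⟶_ : (ℕ → Carrier) → Carrier → Set
  a ⟶ l = ∀ ε → 0# < ε →
    ∃[ N ] (∀ k → N ℕ.≤ k → (l - ε < a k) × (a k < l + ε))

  IsLiminf : (ℕ → Carrier) → Carrier → Set
  IsLiminf a = IsSup λ m →
    ∃[ n ] IsInf (λ y → ∃[ k ] (n ℕ.≤ k × y ≈ a k)) m

module OnlineMatching (ℝ : CompleteOrderedField) where

  open CompleteOrderedField ℝ

  record Graph : Set where
    field
      nU nV : ℕ
      edge  : Fin nU → Fin nV → Bool

    U V : Set
    U = Fin nU
    V = Fin nV

    -- Σ over the edges at i, resp. at t.
    sumAtU : U → (V → Carrier) → Carrier
    sumAtU i f = sum λ t → if edge i t then f t else 0#

    sumAtV : V → (U → Carrier) → Carrier
    sumAtV t f = sum λ i → if edge i t then f i else 0#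

  -- What an order-unaware algorithm knows in advance.  Values of w at
  -- non-edges are never used.
  record UnorderedInstance : Set where
    field
      graph : Graph
    open Graph graph public
    field
      w        : U → V → Carrier
      w-nonneg : ∀ i t → T (edge i t) → 0# ≤ w i t
      p        : V → Carrier
      p-nonneg : ∀ t → 0# ≤ p t
      p≤1      : ∀ t → p t ≤ 1#

  record Instance : Set where
    field
      unordered : UnorderedInstance
    open UnorderedInstance unordered public
    field
      -- order ⟨$⟩ʳ j is the j-th online vertex to arrive.
      order : Permutation′ nV

    arrivals : List V
    arrivals = map (order ⟨$⟩ʳ_) (allFin nV)

  module _ (J : UnorderedInstance) where
    open UnorderedInstance J

    -- An arrival as seen by the algorithm, with the action it took;
    -- realised t nothing means that t was realised and left unmatched.
    data Event : Set where
      unrealised : V → Event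
      realised   : V → Maybe U → Event

    -- Most recent event first.
    History : Set
    History = List Event

    Matched : History → U → Set
    Matched h i = Any (λ e → ∃[ t ] e ≡ realised t (just i)) h

    -- A randomized online algorithm in behavioural form: act h t is the
    -- conditional distribution of the action on the realised arrival t, given
    -- everything that was observed and done before.  The policy sees the past
    -- arrivals only, never the future order.
    record Policy : Set where
      field
        act        : History → V → Maybe U → Carrier
        act-nonneg : ∀ h t a → 0# ≤ act h t a
        act-total  : ∀ h t → act h t nothing + sum (λ i → act h t (just i)) ≈ 1#
        act-edge   : ∀ h t i → ¬ T (edge i t) → act h t (just i) ≈ 0#
        act-free   : ∀ h t i → Matched h i → act h t (just i) ≈ 0#

    -- Expected reward collected from the remaining arrivals, given the
    -- history; computed by conditioning on the realisation of the next vertex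
    -- and on the action drawn by the policy.
    expectedReward : Policy → History → List V → Carrier
    expectedReward π h []       = 0#
    expectedReward π h (t ∷ ts) =
        (1# - p t) * expectedReward π (unrealised t ∷ h) ts
      + p t * ( act h t nothing * expectedReward π (realised t nothing ∷ h) ts
              + sum λ i → act h t (just i) *
                  (w i t + expectedReward π (realised t (just i) ∷ h) ts))
      where open Policy π

  OrderUnawareAlgorithm : Set
  OrderUnawareAlgorithm = (J : UnorderedInstance) → Policy J

  reward : (I : Instance) → Policy (Instance.unordered I) → Carrier
  reward I π = expectedReward (Instance.unordered I) π [] (Instance.arrivals I)

  ALG : OrderUnawareAlgorithm → Instance → Carrier
  ALG alg I = reward I (alg (Instance.unordered I))

  -- For a fixed instance the arrival order is fixed, so an algorithm that also
  -- knows the order may use an arbitrary policy for that instance.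
  IsOPTonline : Instance → Carrier → Set
  IsOPTonline I = IsMaximum λ r → ∃[ π ] r ≈ reward I π

  module _ (I : Instance) where
    open Instance I

    record LPFeasible (x : U → V → Carrier) : Set where
      field
        nonneg    : ∀ i t → T (edge i t) → 0# ≤ x i t
        onlineCap : ∀ t → sumAtV t (λ i → x i t) ≤ p t
        offline   : ∀ i → sumAtU i (λ t → x i t) ≤ 1#

    LPObjective : (U → V → Carrier) → Carrier
    LPObjective x = sum λ i → sumAtU i (λ t → w i t * x i t)

  IsLPexAnte : Instance → Carrier → Set
  IsLPexAnte I = IsMaximum λ r → ∃[ x ] (LPFeasible I x × r ≈ LPObjective I x)

  -- The sequence is indexed from 0.
  record AsymptoticInstance : Set where
    field
      graph : Graph
    open Graph graph public
    field
      order    : Permutation′ nV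
      free     : V → Bool            -- t ∈ F iff free t ≡ true, else t ∈ D
      v        : V → Carrier
      v-nonneg : ∀ t → 0# ≤ v t
      w        : ℕ → U → V → Carrier
      w-nonneg : ∀ k i t → T (edge i t) → 0# ≤ w k i t
      p        : ℕ → V → Carrier
      p-nonneg : ∀ k t → 0# ≤ p k t
      p≤1      : ∀ k t → p k t ≤ 1#

    instanceAt : ℕ → Instance
    instanceAt k = record
      { unordered = record
          { graph    = graph
          ; w        = w k
          ; w-nonneg = w-nonneg k
          ; p        = p k
          ; p-nonneg = p-nonneg k
          ; p≤1      = p≤1 k
          }
      ; order = order
      }

    vU : U → Carrier
    vU i = sum λ t → if free t ∧ edge i t then v t else 0#

    -- Matchings between U and D: M i is the partner of i, if any.
    record IsDMatching (M : U → Maybe V) : Set where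
      field
        isEdge    : ∀ i t → M i ≡ just t → T (edge i t)
        inD       : ∀ i t → M i ≡ just t → free t ≡ false
        injective : ∀ i j t → M i ≡ just t → M j ≡ just t → i ≡ j

    weightAt : ℕ → (U → Maybe V) → U → Carrier
    weightAt k M i = maybe′ (w k i) 0# (M i)

    matchingWeight : ℕ → (U → Maybe V) → Carrier
    matchingWeight k M = sum (weightAt k M)

    IsMaxWeightDMatching : ℕ → (U → Maybe V) → Set
    IsMaxWeightDMatching k M =
      IsDMatching M × (∀ M′ → IsDMatching M′ → matchingWeight k M′ ≤ matchingWeight k M)

  record InClass𝒞 (A : AsymptoticInstance) : Set where
    open AsymptoticInstance A
    field
      det-prob   : ∀ t → free t ≡ false → ∀ k → p k t ≈ 1#
      free-prob  : ∀ t → free t ≡ true → ∀ k → 0# < p k t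
      free-limit : ∀ t → free t ≡ true → (λ k → p k t) ⟶ 0#
      onlineWeight  : ∃ λ (ω : ℕ → V → Carrier) →
                        ((∀ k i t → T (edge i t) → w k i t ≈ ω k t) ×
                         (∀ k t → ω k t * p k t ≈ v t))
      has-neighbour : ∀ t → ∃[ i ] T (edge i t)
      opt-lp : ∃[ opt ] ∃[ lp ] ∃[ l ]
        ((∀ k → IsOPTonline (instanceAt k) (opt k)) ×
         (∀ k → IsLPexAnte (instanceAt k) (lp k)) ×
         opt ⟶ l × lp ⟶ l)
      -- Required of every maximum-weight matching between U and D; v and the
      -- weights of D do not depend on k.
      balanced : ∀ k M → IsMaxWeightDMatching k M → ∀ i → weightAt k M i ≈ vU i
      unique-neighbour : ∀ t → free t ≡ true →
        ∃[ i ] (T (edge i t) × (∀ j → T (edge j t) → i ≡ j))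

{-# OPTIONS --safe #-}
module Submission where

-- Three offline vertices, each with its own free vertex fᵢ, and deterministic
-- vertices d₀ ~ {0,1}, d₁ ~ {0,2}, d₂ ~ {1,2}, all with v = 1.  In the order
-- f₀ f₁ d₀ d₁ f₂ d₂ one should send d₀ to 1, and in f₀ f₁ d₀ d₂ f₂ d₁ to 0; either
-- way all of LP = 6 − 3ε is collected.  When d₀ arrives the two orders still look
-- the same.  If the vertex that is about to be needed is taken, then d₁ (resp. d₂)
-- either blocks 2 before f₂ arrives or stays unmatched, which costs one unit.  So
-- the rewards in the two orders sum to at most 11, and in one of the orders the
-- ratio is infinitely often at most 11 / (12 − 6ε) ≤ 11/12 + ε.

open import Defs
open import Axiom.ExcludedMiddle using (ExcludedMiddle)
open import Data.Bool.Base using (Bool; true; false; if_then_else_; T)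
open import Data.Empty using (⊥-elim)
open import Data.Fin.Base using (Fin; zero; suc)
open import Data.Fin.Patterns using (0F; 1F; 2F; 3F; 4F; 5F)
open import Data.Fin.Permutation as Perm using (Permutation′)
open import Data.Fin.Properties using (_≟_)
open import Data.List.Base using (List; []; _∷_; filter; foldr)
open import Data.List.Relation.Unary.Any using (any?)
open import Data.Maybe.Base using (Maybe; just; nothing)
open import Data.Nat.Base as ℕ using (ℕ; zero; suc; _⊔_)
open import Data.Product.Base using (∃; ∃-syntax; _×_; _,_; proj₁; proj₂)
open import Data.Sum.Base using (_⊎_; inj₁; inj₂; [_,_]′)
open import Data.Unit.Base using (tt)
open import Function.Base using (id)
open import Level using (0ℓ)
open import Relation.Binary.Bundles using (Poset)
open import Relation.Binary.PropositionalEquality.Core as ≡ using (_≡_)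
open import Relation.Binary.Structures using (IsTotalOrder)
open import Relation.Nullary using (¬_; Dec; yes; no; does)
open import Relation.Nullary.Decidable using (map′; T?)

import Algebra.Properties.Ring as RingProperties
import Algebra.Properties.Semiring.Sum as SemiringSum
import Algebra.Solver.Ring.NaturalCoefficients.Default as Solver
import Data.Nat.Properties as ℕₚ
import Relation.Binary.Construct.NonStrictToStrict as Strict
import Relation.Binary.Reasoning.PartialOrder as PosetReasoning

-- The two rewards are added because of randomization: up to `d₀` both runs share the same history
-- and hence the same action probabilities, so the sum is one expectation and can be bounded branch
-- by branch. The constant 11 is 2 + 2 + 7: `f₀` and `f₁` are each worth at most one unit per order,
-- and from `d₀` on the two orders together yield at most 7, although separate optimization would
-- approach 4 in each. The algorithm sees `w` and `p`, so its behaviour may change with the index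
-- `k`, and with it the order that hurts it. One order has to serve for the whole sequence; a
-- classical pigeonhole selects one that is bad for infinitely many `k`, which is enough for a limit
-- inferior. OPT and LP agree at every index, because in either order each offline vertex can wait
-- for its own free vertex and still receive a deterministic one afterwards.

module OrderedField (ℝ : CompleteOrderedField) where

  -- Arithmetic in an ordered field

  open CompleteOrderedField ℝ hiding (zero)

  module ≤ = IsTotalOrder isTotalOrder

  ≤-poset : Poset 0ℓ 0ℓ 0ℓ
  ≤-poset = record { isPartialOrder = ≤.isPartialOrder }

  module ≤-Reasoning = PosetReasoning ≤-poset
  open ≤-Reasoning

  open Solver commutativeSemiring using (solve; con; _:=_; _:+_; _:*_; Polynomial)
  open RingProperties ring using (-‿distribˡ-*; -‿involutive)

  -- Follows the recursion of `fromℕ`, so that the semiring solver can handle numerals in the form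
  -- in which they occur in the goals.
  :fromℕ : ∀ {n} → ℕ → Polynomial n
  :fromℕ zero    = con 0
  :fromℕ (suc m) = con 1 :+ :fromℕ m

  ≤-<-trans : ∀ {x y z} → x ≤ y → y < z → x < z
  ≤-<-trans = Strict.≤-<-trans _≈_ _≤_ ≤.trans ≤.antisym ≤.≤-respˡ-≈

  <-≤-trans : ∀ {x y z} → x < y → y ≤ z → x < z
  <-≤-trans = Strict.<-≤-trans _≈_ _≤_ sym ≤.trans ≤.antisym ≤.≤-respʳ-≈

  <⇒≱ : ∀ {x y} → x < y → ¬ (y ≤ x)
  <⇒≱ = Strict.<⇒≱ _≈_ _≤_ ≤.antisym

  ≰⇒> : ∀ {x y} → ¬ (x ≤ y) → y < x
  ≰⇒> = Strict.≰⇒> _≈_ _≤_ sym ≤.reflexive ≤.total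

  x-y+y≈x : ∀ x y → (x - y) + y ≈ x
  x-y+y≈x x y = trans (+-assoc x (- y) y) (trans (+-congˡ (-‿inverseˡ y)) (+-identityʳ x))

  +-monoʳ-≤ : ∀ z {x y} → x ≤ y → z + x ≤ z + y
  +-monoʳ-≤ z {x} {y} x≤y = begin
    z + x ≈⟨ +-comm z x ⟩
    x + z ≤⟨ +-monoˡ-≤ z x≤y ⟩
    y + z ≈⟨ +-comm y z ⟩
    z + y ∎

  +-mono-≤ : ∀ {x y u v} → x ≤ y → u ≤ v → x + u ≤ y + v
  +-mono-≤ {y = y} {u} x≤y u≤v = ≤.trans (+-monoˡ-≤ u x≤y) (+-monoʳ-≤ y u≤v)

  +-cancelʳ-≤ : ∀ z {x y} → x + z ≤ y + z → x ≤ y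
  +-cancelʳ-≤ z {x} {y} le = begin
    x             ≈⟨ cancel x ⟨
    (x + z) - z   ≤⟨ +-monoˡ-≤ (- z) le ⟩
    (y + z) - z   ≈⟨ cancel y ⟩
    y             ∎
    where
    cancel : ∀ w → (w + z) - z ≈ w
    cancel w = trans (+-assoc w z (- z)) (trans (+-congˡ (-‿inverseʳ z)) (+-identityʳ w))

  +-cancelˡ-≤ : ∀ z {x y} → z + x ≤ z + y → x ≤ y
  +-cancelˡ-≤ z {x} {y} le = +-cancelʳ-≤ z
    (≤.trans (≤.reflexive (+-comm x z)) (≤.trans le (≤.reflexive (+-comm z y))))

  -- Reduces an inequality that follows linearly from l ≤ r to a
  -- subtraction-free identity.
  linear : ∀ {l r x y} → l ≤ r → x + r ≈ y + l → x ≤ y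
  linear {l} {r} {x} {y} l≤r eq = +-cancelʳ-≤ r (begin
    x + r ≈⟨ eq ⟩
    y + l ≤⟨ +-monoʳ-≤ y l≤r ⟩
    y + r ∎)

  x≤x+y : ∀ x {y} → 0# ≤ y → x ≤ x + y
  x≤x+y x {y} 0≤y = linear 0≤y (sym (+-identityʳ (x + y)))

  x≤y+x : ∀ x {y} → 0# ≤ y → x ≤ y + x
  x≤y+x x {y} 0≤y = ≤.trans (x≤x+y x 0≤y) (≤.reflexive (+-comm x y))

  +-nonneg : ∀ {x y} → 0# ≤ x → 0# ≤ y → 0# ≤ x + y
  +-nonneg {x} 0≤x 0≤y = ≤.trans 0≤x (x≤x+y x 0≤y)

  x≤y⇒0≤y-x : ∀ {x y} → x ≤ y → 0# ≤ y - x
  x≤y⇒0≤y-x {x} {y} x≤y = ≤.trans (≤.reflexive (sym (-‿inverseʳ x))) (+-monoˡ-≤ (- x) x≤y)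

  *-monoˡ-≤ : ∀ z {x y} → 0# ≤ z → x ≤ y → z * x ≤ z * y
  *-monoˡ-≤ z {x} {y} 0≤z x≤y = begin
    z * x                 ≤⟨ x≤y+x _ (*-nonneg 0≤z (x≤y⇒0≤y-x x≤y)) ⟩
    z * (y - x) + z * x   ≈⟨ distribˡ z (y - x) x ⟨
    z * ((y - x) + x)     ≈⟨ *-congˡ (x-y+y≈x y x) ⟩
    z * y                 ∎

  *-monoʳ-≤ : ∀ z {x y} → 0# ≤ z → x ≤ y → x * z ≤ y * z
  *-monoʳ-≤ z {x} {y} 0≤z x≤y =
    ≤.trans (≤.reflexive (*-comm x z)) (≤.trans (*-monoˡ-≤ z 0≤z x≤y) (≤.reflexive (*-comm z y)))

  0≤1 : 0# ≤ 1#
  0≤1 with ≤.total 0# 1#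
  ... | inj₁ 0≤1 = 0≤1
  ... | inj₂ 1≤0 = ≤.trans (*-nonneg 0≤-1 0≤-1) (≤.reflexive -1*-1≈1)
    where
    0≤-1 : 0# ≤ - 1#
    0≤-1 = ≤.trans (x≤y⇒0≤y-x 1≤0) (≤.reflexive (+-identityˡ (- 1#)))

    -1*-1≈1 : - 1# * - 1# ≈ 1#
    -1*-1≈1 = trans (sym (-‿distribˡ-* 1# (- 1#)))
      (trans (-‿cong (*-identityˡ (- 1#))) (-‿involutive 1#))

  0<1 : 0# < 1#
  0<1 = 0≤1 , 0≉1

  0≤fromℕ : ∀ n → 0# ≤ fromℕ n
  0≤fromℕ zero    = ≤.refl
  0≤fromℕ (suc n) = +-nonneg 0≤1 (0≤fromℕ n)

  0<fromℕ-suc : ∀ n → 0# < fromℕ (suc n)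
  0<fromℕ-suc n = <-≤-trans 0<1 (x≤x+y 1# (0≤fromℕ n))

  fromℕ-mono-≤ : ∀ {m n} → m ℕ.≤ n → fromℕ m ≤ fromℕ n
  fromℕ-mono-≤ {n = n} ℕ.z≤n     = 0≤fromℕ n
  fromℕ-mono-≤ (ℕ.s≤s m≤n) = +-monoʳ-≤ 1# (fromℕ-mono-≤ m≤n)

  0<x⇒x≉0 : ∀ {x} → 0# < x → ¬ (x ≈ 0#)
  0<x⇒x≉0 (_ , 0≉x) x≈0 = 0≉x (sym x≈0)

  *-inverse : ∀ {x} → 0# < x → x * x ⁻¹ ≈ 1#
  *-inverse 0<x = ⁻¹-inverseʳ _ (0<x⇒x≉0 0<x)

  0<x⇒0<x⁻¹ : ∀ {x} → 0# < x → 0# < x ⁻¹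
  0<x⇒0<x⁻¹ {x} 0<x = ≰⇒> λ x⁻¹≤0 → <⇒≱ 0<1 (begin
    1#        ≈⟨ *-inverse 0<x ⟨
    x * x ⁻¹  ≤⟨ *-monoˡ-≤ x (proj₁ 0<x) x⁻¹≤0 ⟩
    x * 0#    ≈⟨ zeroʳ x ⟩
    0#        ∎)

  x≤y*z⇒x/z≤y : ∀ {x y z} → 0# < z → x ≤ y * z → x / z ≤ y
  x≤y*z⇒x/z≤y {x} {y} {z} 0<z x≤yz = begin
    x * z ⁻¹        ≤⟨ *-monoʳ-≤ (z ⁻¹) (proj₁ (0<x⇒0<x⁻¹ 0<z)) x≤yz ⟩
    y * z * z ⁻¹    ≈⟨ *-assoc y z (z ⁻¹) ⟩
    y * (z * z ⁻¹)  ≈⟨ *-congˡ (*-inverse 0<z) ⟩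
    y * 1#          ≈⟨ *-identityʳ y ⟩
    y               ∎

  halve-≤ : ∀ {x y} → x + x ≤ y + y → x ≤ y
  halve-≤ {x} {y} 2x≤2y with ≤.total x y
  ... | inj₁ x≤y = x≤y
  ... | inj₂ y≤x = linear (+-mono-≤ 2x≤2y y≤x)
    (solve 2 (λ a b → a :+ (b :+ b :+ a) := b :+ (a :+ a :+ b)) refl x y)

  sum-mono : ∀ {n} {f g : Fin n → Carrier} → (∀ i → f i ≤ g i) → sum f ≤ sum g
  sum-mono {zero}  f≤g = ≤.refl
  sum-mono {suc n} f≤g = +-mono-≤ (f≤g zero) (sum-mono λ i → f≤g (suc i))

  sum-nonneg : ∀ {n} {f : Fin n → Carrier} → (∀ i → 0# ≤ f i) → 0# ≤ sum f
  sum-nonneg {zero}  0≤f = ≤.refl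
  sum-nonneg {suc n} 0≤f = +-nonneg (0≤f zero) (sum-nonneg λ i → 0≤f (suc i))

  -- A deficit in one term cannot be made up by the others, since all are capped at 1. This settles
  -- balancedness for every maximum-weight matching at once, without enumerating them.
  sum-saturated : ∀ {n} {f : Fin n → Carrier} → (∀ i → f i ≤ 1#) →
    sum {n} (λ _ → 1#) ≤ sum f → ∀ i → f i ≈ 1#
  sum-saturated {suc n} {f} f≤1 total zero = ≤.antisym (f≤1 zero)
    (linear (+-mono-≤ total (sum-mono λ i → f≤1 (suc i)))
      (solve 4 (λ o a s t → o :+ (a :+ s :+ t) := a :+ (o :+ t :+ s)) refl 1# (f zero) _ _))
  sum-saturated {suc n} {f} f≤1 total (suc i) = sum-saturated (λ j → f≤1 (suc j))
    (linear (+-mono-≤ total (f≤1 zero))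
      (solve 4 (λ o a s t → t :+ (a :+ s :+ o) := s :+ (o :+ t :+ a)) refl 1# (f zero) _ _)) i

  -- Infima, limits inferior and the Archimedean property

  IsSup-≤ : ∀ {S s b} → IsSup S s → (∀ x → S x → x ≤ b) → s ≤ b
  IsSup-≤ (_ , least) ub = least _ ub

  -- Completeness is stated for suprema; the infimum is the supremum of the set of lower bounds.
  inf-exists : ∀ (S : Carrier → Set) → ∃ S → ∃ (LowerBound S) → ∃ (IsInf S)
  inf-exists S (x , Sx) lb =
    let s , ub , least = complete (LowerBound S) lb (x , λ b lb → lb x Sx)
    in s , (λ y Sy → least y λ b lb → lb y Sy) , ub

  -- Nonnegativity makes all tail infima exist. Every tail contains a term at most `b`, so all these
  -- infima, and hence their supremum, are at most `b`.
  liminf-bound : ∀ (a : ℕ → Carrier) {b} → (∀ k → 0# ≤ a k) →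
    (∀ n → ∃[ k ] (n ℕ.≤ k × a k ≤ b)) → ∃[ l ] (IsLiminf a l × l ≤ b)
  liminf-bound a {b} 0≤a often =
    let l , isSup = complete Infima
          (proj₁ (tailInf 0) , 0 , proj₂ (tailInf 0)) (b , bounded)
    in l , isSup , IsSup-≤ isSup bounded
    where
    Tail : ℕ → Carrier → Set
    Tail n y = ∃[ k ] (n ℕ.≤ k × y ≈ a k)

    Infima : Carrier → Set
    Infima m = ∃[ n ] IsInf (Tail n) m

    tailInf : ∀ n → ∃ (IsInf (Tail n))
    tailInf n = inf-exists (Tail n) (a n , n , ℕₚ.≤-refl , refl)
      (0# , λ { y (k , _ , y≈a) → ≤.trans (0≤a k) (≤.reflexive (sym y≈a)) })

    bounded : UpperBound Infima b
    bounded m (n , lower , _) =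
      let k , n≤k , ak≤b = often n in ≤.trans (lower (a k) (k , n≤k , refl)) ak≤b

  module _ (em : ExcludedMiddle 0ℓ) where

    infinitely-often : ∀ {P Q : ℕ → Set} → (∀ k → P k ⊎ Q k) →
      (∀ n → ∃[ k ] (n ℕ.≤ k × P k)) ⊎ (∀ n → ∃[ k ] (n ℕ.≤ k × Q k))
    infinitely-often {P} {Q} either with em {∀ n → ∃[ k ] (n ℕ.≤ k × P k)}
    ... | yes often = inj₁ often
    ... | no ¬often = inj₂ Q-beyond
      where
      Q-beyond : ∀ n → ∃[ k ] (n ℕ.≤ k × Q k)
      Q-beyond n with em {∃[ k ] (n ℕ.≤ k × Q k)}
      ... | yes found = found
      -- If `Q` fails from `n` on, then `P` holds at `m ⊔ n` for every `m`, hence infinitely often.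
      ... | no ¬found = ⊥-elim (¬often λ m → m ⊔ n , ℕₚ.m≤m⊔n m n ,
              [ id , (λ q → ⊥-elim (¬found (m ⊔ n , ℕₚ.m≤n⊔m m n , q))) ]′ (either (m ⊔ n)))

    -- Otherwise the naturals have a supremum `s`; since `n + 1` is again a natural, `s - 1#` is an
    -- upper bound too, which is absurd.
    archimedean : ∀ x → ∃[ N ] x < fromℕ N
    archimedean x with em {∃[ N ] x < fromℕ N}
    ... | yes found = found
    ... | no ¬∃ = ⊥-elim (<⇒≱ 0<1 (linear s≤s-1 identity))
      where
      S : Carrier → Set
      S y = ∃[ n ] y ≈ fromℕ n

      bounded : UpperBound S x
      bounded y (n , y≈n) = ≤.trans (≤.reflexive y≈n) n≤x
        where
        n≤x : fromℕ n ≤ x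
        n≤x with em {fromℕ n ≤ x}
        ... | yes n≤x = n≤x
        ... | no n≰x  = ⊥-elim (¬∃ (n , ≰⇒> n≰x))

      supremum : ∃ (IsSup S)
      supremum = complete S (0# , zero , refl) (x , bounded)

      s : Carrier
      s = proj₁ supremum

      s≤s-1 : s ≤ s - 1#
      s≤s-1 = IsSup-≤ (proj₂ supremum) λ { y (n , y≈n) → +-cancelʳ-≤ 1# (begin
        y + 1#            ≈⟨ +-congʳ y≈n ⟩
        fromℕ n + 1#      ≈⟨ +-comm (fromℕ n) 1# ⟩
        fromℕ (suc n)     ≤⟨ proj₁ (proj₂ supremum) _ (suc n , refl) ⟩
        s                 ≈⟨ x-y+y≈x s 1# ⟨
        (s - 1#) + 1#     ∎) }

      identity : 1# + (s - 1#) ≈ 0# + s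
      identity = trans (+-comm 1# (s - 1#)) (trans (x-y+y≈x s 1#) (sym (+-identityˡ s)))

    reciprocal-small : ∀ x {ε} → 0# < ε →
      ∃[ N ] ∀ k → N ℕ.≤ k → x * fromℕ (suc k) ⁻¹ < ε
    reciprocal-small x {ε} 0<ε with archimedean (x * ε ⁻¹)
    ... | N , x/ε<N = N , λ k N≤k → ≰⇒> λ ε≤x/n → <⇒≱ x/ε<N (begin
      fromℕ N                       ≤⟨ fromℕ-mono-≤ (ℕₚ.≤-trans N≤k (ℕₚ.n≤1+n k)) ⟩
      fromℕ (suc k)                 ≤⟨ lemma k ε≤x/n ⟩
      x * ε ⁻¹                      ∎)
      where
      lemma : ∀ k → ε ≤ x * fromℕ (suc k) ⁻¹ → fromℕ (suc k) ≤ x * ε ⁻¹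
      lemma k ε≤x/n = begin
        n                         ≈⟨ *-identityʳ n ⟨
        n * 1#                    ≈⟨ *-congˡ (*-inverse 0<ε) ⟨
        n * (ε * ε ⁻¹)            ≈⟨ *-assoc n ε (ε ⁻¹) ⟨
        n * ε * ε ⁻¹              ≤⟨ *-monoʳ-≤ (ε ⁻¹) (proj₁ (0<x⇒0<x⁻¹ 0<ε))
                                       (*-monoˡ-≤ n (0≤fromℕ (suc k)) ε≤x/n) ⟩
        n * (x * n ⁻¹) * ε ⁻¹
          ≈⟨ *-congʳ (solve 3 (λ a b c → a :* (b :* c) := b :* (a :* c)) refl n x (n ⁻¹)) ⟩
        x * (n * n ⁻¹) * ε ⁻¹     ≈⟨ *-congʳ (*-congˡ (*-inverse (0<fromℕ-suc k))) ⟩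
        x * 1# * ε ⁻¹             ≈⟨ *-congʳ (*-identityʳ x) ⟩
        x * ε ⁻¹                  ∎
        where n = fromℕ (suc k)

-- Rewards of arbitrary policies on one instance

module Policies (ℝ : CompleteOrderedField)
  (J : OnlineMatching.UnorderedInstance ℝ) where

  open CompleteOrderedField ℝ hiding (zero)
  open OrderedField ℝ
  open ≤-Reasoning
  open OnlineMatching ℝ
  open UnorderedInstance J
  open Solver commutativeSemiring using (solve; con; _:=_; _:+_; _:*_)
  open SemiringSum semiring using (*-distribʳ-sum;
    *-distribˡ-sum; sum-cong-≋; ∑-distrib-+; sum-replicate; sum-replicate-zero)

  inOrder : Permutation′ nV → Instance
  inOrder σ = record { unordered = J ; order = σ }

  -- With I kept apart from inOrder σ, concrete uses compare instances by η and
  -- never unfold the rewards.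
  ALG-inOrder : ∀ alg σ {I ts} → inOrder σ ≡ I → Instance.arrivals (inOrder σ) ≡ ts →
    ALG alg I ≡ expectedReward J (alg J) [] ts
  ALG-inOrder alg σ ≡.refl ≡.refl = ≡.refl

  matched? : ∀ (h : History J) i → Dec (Matched J h i)
  matched? h i = any? matchesTo? h
    where
    matchesTo? : ∀ e → Dec (∃[ t ] e ≡ realised t (just i))
    matchesTo? (unrealised t)        = no λ ()
    matchesTo? (realised t nothing)  = no λ ()
    matchesTo? (realised t (just j)) =
      map′ (λ { ≡.refl → t , ≡.refl }) (λ { (_ , ≡.refl) → ≡.refl }) (j ≟ i)

  -- A number rather than a proposition, so that reward bounds can be linear expressions in it and
  -- cover the vacant and the occupied case together.
  vacancy : History J → U → Carrier
  vacancy h i = if does (matched? h i) then 0# else 1#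

  vacancy-unmatched : ∀ h i → ¬ Matched J h i → vacancy h i ≈ 1#
  vacancy-unmatched h i ¬m with matched? h i
  ... | yes m = ⊥-elim (¬m m)
  ... | no _  = refl

  vacancy-nonneg : ∀ h i → 0# ≤ vacancy h i
  vacancy-nonneg h i with matched? h i
  ... | yes _ = ≤.refl
  ... | no _  = 0≤1

  vacancy≤1 : ∀ h i → vacancy h i ≤ 1#
  vacancy≤1 h i with matched? h i
  ... | yes _ = 0≤1
  ... | no _  = ≤.refl

  vacancy-matched : ∀ h i → Matched J h i → vacancy h i ≈ 0#
  vacancy-matched h i m with matched? h i
  ... | yes _ = refl
  ... | no ¬m = ⊥-elim (¬m m)

  sum-indicator : ∀ {n} (i : Fin n) (f : Fin n → Carrier) →
    sum (λ j → if does (i ≟ j) then f j else 0#) ≈ f i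
  sum-indicator {suc n} zero    f = trans (+-congˡ (sum-replicate-zero n)) (+-identityʳ (f zero))
  sum-indicator {suc n} (suc i) f = trans (+-identityˡ _) (sum-indicator i (λ j → f (suc j)))

  0≤1-p : ∀ t → 0# ≤ 1# - p t
  0≤1-p t = x≤y⇒0≤y-x (p≤1 t)

  p-convex : ∀ t x → (1# - p t) * x + p t * x ≈ x
  p-convex t x = trans (sym (distribʳ x (1# - p t) (p t)))
    (trans (*-congʳ (x-y+y≈x 1# (p t))) (*-identityˡ x))

  totalVacancy : History J → Carrier
  totalVacancy h = sum (vacancy h)

  totalVacancy-match : ∀ t h i → ¬ Matched J h i →
    1# + totalVacancy (realised t (just i) ∷ h) ≈ totalVacancy h
  totalVacancy-match t h i ¬m = trans (+-congʳ (sym (sum-indicator i (λ _ → 1#))))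
    (trans (sym (∑-distrib-+ (λ j → if does (i ≟ j) then 1# else 0#) _)) (sum-cong-≋ pointwise))
    where
    pointwise : ∀ j → (if does (i ≟ j) then 1# else 0#) + vacancy (realised t (just i) ∷ h) j
                      ≈ vacancy h j
    pointwise j with i ≟ j
    ... | yes ≡.refl = trans (+-identityʳ 1#) (sym (vacancy-unmatched h i ¬m))
    ... | no _       = +-identityˡ _

  module _ (π : Policy J) where
    open Policy π

    -- The conditional expectation over the outcome of the next arrival, so that
    -- expectedReward π h (t ∷ ts) is an instance of it by definition.
    mix : History J → V → Carrier → Carrier → (U → Carrier) → Carrier
    mix h t x y f =
      (1# - p t) * x + p t * (act h t nothing * y + sum λ i → act h t (just i) * f i)

    -- The comparison of `f` with `f′` is demanded for legal moves only: a policy gives probability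
    -- zero to non-edges and to occupied vertices.
    mix-mono : ∀ h t {x x′ y y′ f f′} → x ≤ x′ → y ≤ y′ →
      (∀ i → T (edge i t) → ¬ Matched J h i → f i ≤ f′ i) →
      mix h t x y f ≤ mix h t x′ y′ f′
    mix-mono h t {f = f} {f′} x≤x′ y≤y′ f≤f′ = +-mono-≤ (*-monoˡ-≤ _ (0≤1-p t) x≤x′)
      (*-monoˡ-≤ _ (p-nonneg t) (+-mono-≤ (*-monoˡ-≤ _ (act-nonneg h t nothing) y≤y′)
        (sum-mono pointwise)))
      where
      vanishing : ∀ i → act h t (just i) ≈ 0# →
        act h t (just i) * f i ≤ act h t (just i) * f′ i
      vanishing i eq = ≤.reflexive (trans (trans (*-congʳ eq) (zeroˡ _))
        (sym (trans (*-congʳ eq) (zeroˡ _))))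

      pointwise : ∀ i → act h t (just i) * f i ≤ act h t (just i) * f′ i
      pointwise i with T? (edge i t) | matched? h i
      ... | no ¬e | _     = vanishing i (act-edge h t i ¬e)
      ... | yes _ | yes m = vanishing i (act-free h t i m)
      ... | yes e | no ¬m = *-monoˡ-≤ _ (act-nonneg h t (just i)) (f≤f′ i e ¬m)

    mix-const : ∀ h t x y → mix h t x y (λ _ → y) ≈ (1# - p t) * x + p t * y
    mix-const h t x y = +-congˡ (*-congˡ (begin-equality
      act h t nothing * y + sum (λ i → act h t (just i) * y)
        ≈⟨ +-congˡ (*-distribʳ-sum y (λ i → act h t (just i))) ⟨
      act h t nothing * y + sum (λ i → act h t (just i)) * y
        ≈⟨ distribʳ y _ _ ⟨
      (act h t nothing + sum (λ i → act h t (just i))) * y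
        ≈⟨ *-congʳ (act-total h t) ⟩
      1# * y
        ≈⟨ *-identityˡ y ⟩
      y ∎))

    -- Here `c` bounds what follows when nothing is matched, and `d` is the surplus that a match may
    -- bring. The surplus is charged with the factor `p t`, which keeps the bound useful for a free
    -- vertex, whose weight is huge but whose probability is small.
    mix-≤ : ∀ h t {x y f c d} → 0# ≤ d → x ≤ c → y ≤ c →
      (∀ i → T (edge i t) → ¬ Matched J h i → f i ≤ c + d) →
      mix h t x y f ≤ c + p t * d
    mix-≤ h t {x} {y} {f} {c} {d} 0≤d x≤c y≤c f≤c+d = begin
      mix h t x y f
        ≤⟨ mix-mono h t x≤c (≤.trans y≤c (x≤x+y c 0≤d)) f≤c+d ⟩
      mix h t c (c + d) (λ _ → c + d)             ≈⟨ mix-const h t c (c + d) ⟩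
      (1# - p t) * c + p t * (c + d)              ≈⟨ +-congˡ (distribˡ (p t) c d) ⟩
      (1# - p t) * c + (p t * c + p t * d)        ≈⟨ +-assoc _ _ _ ⟨
      (1# - p t) * c + p t * c + p t * d          ≈⟨ +-congʳ (p-convex t c) ⟩
      c + p t * d                                 ∎

    mix-≥0 : ∀ h t {x y f} → 0# ≤ x → 0# ≤ y →
      (∀ i → T (edge i t) → ¬ Matched J h i → 0# ≤ f i) → 0# ≤ mix h t x y f
    mix-≥0 h t 0≤x 0≤y 0≤f = ≤.trans
      (≤.reflexive (sym (trans (mix-const h t 0# 0#) (p-convex t 0#))))
      (mix-mono h t 0≤x 0≤y 0≤f)

    mix-+ : ∀ h t x y f x′ y′ f′ →
      mix h t x y f + mix h t x′ y′ f′ ≈ mix h t (x + x′) (y + y′) (λ i → f i + f′ i)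
    mix-+ h t x y f x′ y′ f′ = trans
      (solve 9 (λ q x x′ p a y y′ s s′ →
          (q :* x :+ p :* (a :* y :+ s)) :+ (q :* x′ :+ p :* (a :* y′ :+ s′)) :=
          q :* (x :+ x′) :+ p :* (a :* (y :+ y′) :+ (s :+ s′)))
        refl (1# - p t) x x′ (p t) (act h t nothing) y y′ _ _)
      (+-congˡ (*-congˡ (+-congˡ (trans (sym (∑-distrib-+ _ (λ i → act h t (just i) * f′ i)))
        (sum-cong-≋ λ i → sym (distribˡ (act h t (just i)) (f i) (f′ i)))))))

    private
      E : History J → List V → Carrier
      E = expectedReward J π

    -- This is where order-unawareness enters. The action probabilities depend on `h` and `t` but
    -- not on the remaining arrivals, so the rewards for two continuations are averages with the
    -- same coefficients and add up to a single `mix`.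
    joint-≤ : ∀ h t {ts ts′ c d} → 0# ≤ d →
      (∀ {h′} → E h′ ts + E h′ ts′ ≤ c) →
      (∀ i → T (edge i t) → ¬ Matched J h i → let h′ = realised t (just i) ∷ h in
        (w i t + E h′ ts) + (w i t + E h′ ts′) ≤ c + d) →
      E h (t ∷ ts) + E h (t ∷ ts′) ≤ c + p t * d
    joint-≤ h t {ts} {ts′} 0≤d rest matched = ≤.trans
      (≤.reflexive (mix-+ h t (E (unrealised t ∷ h) ts) (E (realised t nothing ∷ h) ts)
        (λ i → w i t + E (realised t (just i) ∷ h) ts)
        (E (unrealised t ∷ h) ts′) (E (realised t nothing ∷ h) ts′)
        (λ i → w i t + E (realised t (just i) ∷ h) ts′)))
      (mix-≤ h t 0≤d rest rest matched)

    expectedReward-nonneg : ∀ h ts → 0# ≤ expectedReward J π h ts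
    expectedReward-nonneg h []       = ≤.refl
    expectedReward-nonneg h (t ∷ ts) = mix-≥0 h t (expectedReward-nonneg _ ts)
      (expectedReward-nonneg _ ts)
      (λ i e _ → +-nonneg (w-nonneg i t e) (expectedReward-nonneg _ ts))

    -- Each match uses up one unit of vacancy, so only the excess of a weight
    -- over 1 has to be paid for separately.
    expectedReward-≤ : ∀ {d : V → Carrier} → (∀ t → 0# ≤ d t) →
      (∀ i t → T (edge i t) → w i t ≤ 1# + d t) → ∀ h ts →
      expectedReward J π h ts ≤ totalVacancy h + foldr (λ t s → p t * d t + s) 0# ts
    expectedReward-≤ {d} 0≤d w≤1+d h []       =
      ≤.trans (sum-nonneg (vacancy-nonneg h)) (≤.reflexive (sym (+-identityʳ _)))
    expectedReward-≤ {d} 0≤d w≤1+d h (t ∷ ts) = begin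
      expectedReward J π h (t ∷ ts)           ≤⟨ mix-≤ h t (0≤d t) (ih _) (ih _) matched ⟩
      totalVacancy h + S + p t * d t
        ≈⟨ solve 3 (λ n s e → n :+ s :+ e := n :+ (e :+ s)) refl _ _ _ ⟩
      totalVacancy h + (p t * d t + S)        ∎
      where
      S : Carrier
      S = foldr (λ t s → p t * d t + s) 0# ts

      ih : ∀ h → expectedReward J π h ts ≤ totalVacancy h + S
      ih h = expectedReward-≤ 0≤d w≤1+d h ts

      matched : ∀ i → T (edge i t) → ¬ Matched J h i →
        w i t + expectedReward J π (realised t (just i) ∷ h) ts ≤ totalVacancy h + S + d t
      matched i e ¬m = begin
        w i t + expectedReward J π h′ ts          ≤⟨ +-mono-≤ (w≤1+d i t e) (ih h′) ⟩
        (1# + d t) + (totalVacancy h′ + S)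
          ≈⟨ solve 4 (λ one e n s → (one :+ e) :+ (n :+ s) := (one :+ n) :+ s :+ e)
               refl 1# (d t) _ S ⟩
        (1# + totalVacancy h′) + S + d t
          ≈⟨ +-congʳ (+-congʳ (totalVacancy-match t h i ¬m)) ⟩
        totalVacancy h + S + d t                  ∎
        where h′ = realised t (just i) ∷ h

  -- Policies that send each online vertex to a prescribed target

  module Greedy (target : V → U) (target-edge : ∀ t → T (edge (target t) t)) where

    occupancy : History J → U → Carrier
    occupancy h i = if does (matched? h i) then 1# else 0#

    occupancy+vacancy≈1 : ∀ h i → occupancy h i + vacancy h i ≈ 1#
    occupancy+vacancy≈1 h i with matched? h i
    ... | yes _ = +-identityʳ 1#
    ... | no _  = +-identityˡ 1#

    occupancy-nonneg : ∀ h i → 0# ≤ occupancy h i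
    occupancy-nonneg h i with matched? h i
    ... | yes _ = 0≤1
    ... | no _  = ≤.refl

    greedyAct : History J → V → Maybe U → Carrier
    greedyAct h t nothing  = occupancy h (target t)
    greedyAct h t (just i) = if does (target t ≟ i) then vacancy h i else 0#

    greedy : Policy J
    greedy = record
      { act        = greedyAct
      ; act-nonneg = nonneg
      ; act-total  = λ h t → trans (+-congˡ (sum-indicator (target t) (vacancy h)))
                               (occupancy+vacancy≈1 h (target t))
      ; act-edge   = off-edge
      ; act-free   = occupied
      }
      where
      nonneg : ∀ h t a → 0# ≤ greedyAct h t a
      nonneg h t nothing = occupancy-nonneg h (target t)
      nonneg h t (just i) with target t ≟ i
      ... | yes _ = vacancy-nonneg h i
      ... | no _  = ≤.refl

      off-edge : ∀ h t i → ¬ T (edge i t) → greedyAct h t (just i) ≈ 0#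
      off-edge h t i ¬e with target t ≟ i
      ... | yes ≡.refl = ⊥-elim (¬e (target-edge t))
      ... | no _       = refl

      occupied : ∀ h t i → Matched J h i → greedyAct h t (just i) ≈ 0#
      occupied h t i m with target t ≟ i
      ... | yes _ = vacancy-matched h i m
      ... | no _  = refl

    -- What a vacant i is worth when ts is still to come.
    value : List V → U → Carrier
    value []       i = 0#
    value (t ∷ ts) i =
      (1# - p t) * value ts i + p t * (if does (target t ≟ i) then w i t else value ts i)

    -- An arrival affects the vacancy of its own target only, so the offline vertices do not
    -- interact and the reward splits into a sum over them.
    greedy-reward : ∀ h ts →
      expectedReward J greedy h ts ≈ sum (λ i → vacancy h i * value ts i)
    greedy-reward h [] = sym (trans (sum-cong-≋ λ i → zeroʳ (vacancy h i)) (sum-replicate-zero nU))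
    greedy-reward h (t ∷ ts) = begin-equality
      expectedReward J greedy h (t ∷ ts)
        ≈⟨ +-cong (*-congˡ (greedy-reward _ ts))
             (*-congˡ (trans (+-cong (*-congˡ (greedy-reward _ ts)) toTarget)
               realisedStep)) ⟩
      (1# - p t) * sum (λ i → vacancy h i * value ts i) + p t * sum (λ i → vacancy h i * next i)
        ≈⟨ +-cong (*-distribˡ-sum _ (λ i → vacancy h i * value ts i))
                  (*-distribˡ-sum _ (λ i → vacancy h i * next i)) ⟩
      sum (λ i → (1# - p t) * (vacancy h i * value ts i)) + sum (λ i → p t * (vacancy h i * next i))
        ≈⟨ ∑-distrib-+ (λ i → (1# - p t) * (vacancy h i * value ts i)) _ ⟨
      sum (λ i → (1# - p t) * (vacancy h i * value ts i) + p t * (vacancy h i * next i))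
        ≈⟨ sum-cong-≋ (λ i → solve 5 (λ q v x p y →
             q :* (v :* x) :+ p :* (v :* y) := v :* (q :* x :+ p :* y)) refl
             (1# - p t) (vacancy h i) (value ts i) (p t) (next i)) ⟩
      sum (λ i → vacancy h i * value (t ∷ ts) i) ∎
      where
      τ : U
      τ = target t

      next : U → Carrier
      next i = if does (τ ≟ i) then w i t else value ts i

      h′ : History J
      h′ = realised t (just τ) ∷ h

      current after : Carrier
      current = sum (λ i → vacancy h i * value ts i)
      after   = sum (λ i → vacancy h′ i * value ts i)

      toTarget : sum (λ i → greedyAct h t (just i) *
                   (w i t + expectedReward J greedy (realised t (just i) ∷ h) ts))
                 ≈ vacancy h τ * (w τ t + after)
      toTarget = trans (sum-cong-≋ inside)
        (trans (sum-indicator τ _) (*-congˡ (+-congˡ (greedy-reward h′ ts))))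
        where
        gain : U → Carrier
        gain i = w i t + expectedReward J greedy (realised t (just i) ∷ h) ts

        inside : ∀ i → (if does (τ ≟ i) then vacancy h i else 0#) * gain i
                       ≈ (if does (τ ≟ i) then vacancy h i * gain i else 0#)
        inside i with does (τ ≟ i)
        ... | true  = refl
        ... | false = zeroˡ (gain i)

      realisedStep : occupancy h τ * current + vacancy h τ * (w τ t + after)
                     ≈ sum (λ i → vacancy h i * next i)
      realisedStep with matched? h τ
      -- Target occupied: the arrival is skipped, and the summands could differ only at `τ`, where
      -- the vacancy is zero.
      ... | yes m = trans (+-cong (*-identityˡ _) (zeroˡ _)) (trans (+-identityʳ _)
                      (sum-cong-≋ pointwise))
        where
        pointwise : ∀ i → vacancy h i * value ts i ≈ vacancy h i * next i
        pointwise i with τ ≟ i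
        ... | no _       = refl
        ... | yes ≡.refl = trans (*-congʳ vac≈0) (trans (zeroˡ _)
                             (sym (trans (*-congʳ vac≈0) (zeroˡ _))))
          where vac≈0 = vacancy-matched h τ m
      -- Target vacant: its summand drops out of `after`, and the collected weight takes the free
      -- place.
      ... | no ¬m = trans (+-cong (zeroˡ _) (*-identityˡ _)) (trans (+-identityˡ _)
                      (trans (+-congʳ (sym (sum-indicator τ (λ i → w i t))))
                        (trans (sym (∑-distrib-+ (λ i → if does (τ ≟ i) then w i t else 0#) _))
                          (sum-cong-≋ pointwise))))
        where
        pointwise : ∀ i → (if does (τ ≟ i) then w i t else 0#) + vacancy h′ i * value ts i
                          ≈ vacancy h i * next i
        pointwise i with τ ≟ i
        ... | no _       = +-identityˡ _
        ... | yes ≡.refl = trans (+-congˡ (zeroˡ _)) (trans (+-identityʳ _)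
                             (sym (trans (*-congʳ (vacancy-unmatched h τ ¬m)) (*-identityˡ _))))

    -- An arrival with another target averages two equal numbers. On the hard instance this leaves
    -- only two arrivals per offline vertex.
    value-filter : ∀ ts i → value ts i ≈ value (filter (λ t → target t ≟ i) ts) i
    value-filter []       i = refl
    value-filter (t ∷ ts) i with target t ≟ i in eq
    ... | no _  = trans (p-convex t (value ts i)) (value-filter ts i)
    ... | yes _ rewrite eq = +-congʳ (*-congˡ (value-filter ts i))

    -- Optimality by matching bounds: `greedy-reward` gives what the greedy policy earns,
    -- `expectedReward-≤` caps every policy, and the hypotheses ask that both numbers equal `r`.
    greedy-isOPTonline : ∀ σ {I ts r} {d : V → Carrier} →
      inOrder σ ≡ I → Instance.arrivals (inOrder σ) ≡ ts → (∀ t → 0# ≤ d t) →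
      (∀ i t → T (edge i t) → w i t ≤ 1# + d t) →
      sum (value ts) ≈ r → fromℕ nU + foldr (λ t s → p t * d t + s) 0# ts ≈ r →
      IsOPTonline I r
    greedy-isOPTonline σ {ts = ts} {r} ≡.refl ≡.refl 0≤d w≤1+d value≈r bound≈r =
      (greedy , attained) , upper
      where
      attained : r ≈ reward (inOrder σ) greedy
      attained = sym (trans (greedy-reward [] ts)
        (trans (sum-cong-≋ λ i → *-identityˡ (value ts i)) value≈r))

      upper : UpperBound (λ x → ∃[ π ] x ≈ reward (inOrder σ) π) r
      upper x (π , x≈) = begin
        x                                 ≈⟨ x≈ ⟩
        reward (inOrder σ) π              ≤⟨ expectedReward-≤ π 0≤d w≤1+d [] ts ⟩
        totalVacancy [] + _               ≈⟨ +-congʳ (sum-replicate nU) ⟩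
        fromℕ nU + _                      ≈⟨ bound≈r ⟩
        r                                 ∎

-- The hard instance and its membership in the class

module HardInstance (ℝ : CompleteOrderedField) where

  open CompleteOrderedField ℝ hiding (zero) renaming (reflexive to ≈-reflexive)
  open OrderedField ℝ
  open ≤-Reasoning
  open OnlineMatching ℝ
  open Policies ℝ
  open Solver commutativeSemiring using (solve; con; _:=_; _:+_; _:*_)
  open SemiringSum semiring using (sum-cong-≋)

  -- The numbering follows the first arrival order, whose permutation is therefore the identity.
  pattern f₀ = 0F
  pattern f₁ = 1F
  pattern d₀ = 2F
  pattern d₁ = 3F
  pattern f₂ = 4F
  pattern d₂ = 5F

  adjacent : Fin 3 → Fin 6 → Bool
  adjacent 0F f₀ = true
  adjacent 0F d₀ = true
  adjacent 0F d₁ = true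
  adjacent 1F f₁ = true
  adjacent 1F d₀ = true
  adjacent 1F d₂ = true
  adjacent 2F f₂ = true
  adjacent 2F d₁ = true
  adjacent 2F d₂ = true
  adjacent _  _  = false

  isFree : Fin 6 → Bool
  isFree f₀ = true
  isFree f₁ = true
  isFree f₂ = true
  isFree _  = false

  hardGraph : Graph
  hardGraph = record { nU = 3 ; nV = 6 ; edge = adjacent }

  ε : ℕ → Carrier
  ε k = fromℕ (suc k) ⁻¹

  -- Probabilities, weights, and the part of the weight above 1. A free vertex has weight `k + 1`
  -- and probability `1 / (k + 1)`, so that its value stays 1 while its probability vanishes.
  ρ ω excess : ℕ → Fin 6 → Carrier
  ρ k t      = if isFree t then ε k else 1#
  ω k t      = if isFree t then fromℕ (suc k) else 1#
  excess k t = if isFree t then fromℕ k else 0#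

  ε-inverse : ∀ k → ε k * fromℕ (suc k) ≈ 1#
  ε-inverse k = trans (*-comm _ _) (*-inverse (0<fromℕ-suc k))

  0<ε : ∀ k → 0# < ε k
  0<ε k = 0<x⇒0<x⁻¹ (0<fromℕ-suc k)

  -- Thus `ε k * fromℕ k` stands for the complementary probability 1 - ε, which keeps later
  -- identities within commutative semirings.
  ε-identity : ∀ k → ε k + ε k * fromℕ k ≈ 1#
  ε-identity k = trans (solve 2 (λ e m → e :+ e :* m := e :* (con 1 :+ m)) refl (ε k) (fromℕ k))
    (ε-inverse k)

  0≤ε*k : ∀ k → 0# ≤ ε k * fromℕ k
  0≤ε*k k = *-nonneg (proj₁ (0<ε k)) (0≤fromℕ k)

  ε≤1 : ∀ k → ε k ≤ 1#
  ε≤1 k = ≤.trans (x≤x+y (ε k) (0≤ε*k k)) (≤.reflexive (ε-identity k))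

  ε*k≤1 : ∀ k → ε k * fromℕ k ≤ 1#
  ε*k≤1 k = ≤.trans (x≤y+x _ (proj₁ (0<ε k))) (≤.reflexive (ε-identity k))

  ρ-nonneg : ∀ k t → 0# ≤ ρ k t
  ρ-nonneg k t with isFree t
  ... | true  = proj₁ (0<ε k)
  ... | false = 0≤1

  ρ≤1 : ∀ k t → ρ k t ≤ 1#
  ρ≤1 k t with isFree t
  ... | true  = ε≤1 k
  ... | false = ≤.refl

  ω-nonneg : ∀ k t → 0# ≤ ω k t
  ω-nonneg k t with isFree t
  ... | true  = 0≤fromℕ (suc k)
  ... | false = 0≤1

  excess-nonneg : ∀ k t → 0# ≤ excess k t
  excess-nonneg k t with isFree t
  ... | true  = 0≤fromℕ k
  ... | false = ≤.refl

  ω≈1+excess : ∀ k t → ω k t ≈ 1# + excess k t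
  ω≈1+excess k t with isFree t
  ... | true  = refl
  ... | false = sym (+-identityʳ 1#)

  ω*ρ≈1 : ∀ k t → ω k t * ρ k t ≈ 1#
  ω*ρ≈1 k t with isFree t
  ... | true  = *-inverse (0<fromℕ-suc k)
  ... | false = *-identityˡ 1#

  hardOrder : Bool → Permutation′ 6
  hardOrder false = Perm.id
  hardOrder true  = Perm.transpose d₁ d₂

  hard : Bool → AsymptoticInstance
  hard b = record
    { graph    = hardGraph
    ; order    = hardOrder b
    ; free     = isFree
    ; v        = λ _ → 1#
    ; v-nonneg = λ _ → 0≤1
    ; w        = λ k _ → ω k
    ; w-nonneg = λ k _ t _ → ω-nonneg k t
    ; p        = ρ
    ; p-nonneg = ρ-nonneg
    ; p≤1      = ρ≤1
    }

  open AsymptoticInstance using (instanceAt)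

  J : ℕ → UnorderedInstance
  J k = record
    { graph    = hardGraph
    ; w        = λ _ → ω k
    ; w-nonneg = λ _ t _ → ω-nonneg k t
    ; p        = ρ k
    ; p-nonneg = ρ-nonneg k
    ; p≤1      = ρ≤1 k
    }

  -- share k = 2 − ε k, written without subtraction.
  share opt : ℕ → Carrier
  share k = 1# + ε k * fromℕ k
  opt k   = sum {3} λ _ → share k

  -- In both orders each offline vertex is the target of its free vertex and, later on, of exactly
  -- one deterministic vertex.
  target : Bool → Fin 6 → Fin 3
  target _     f₀ = 0F
  target _     f₁ = 1F
  target _     f₂ = 2F
  target false d₀ = 1F
  target false d₁ = 0F
  target false d₂ = 2F
  target true  d₀ = 0F
  target true  d₁ = 2F
  target true  d₂ = 1F

  target-adjacent : ∀ b t → T (adjacent (target b t) t)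
  target-adjacent _     f₀ = tt
  target-adjacent _     f₁ = tt
  target-adjacent _     f₂ = tt
  target-adjacent false d₀ = tt
  target-adjacent false d₁ = tt
  target-adjacent false d₂ = tt
  target-adjacent true  d₀ = tt
  target-adjacent true  d₁ = tt
  target-adjacent true  d₂ = tt

  arrivals : Bool → List (Fin 6)
  arrivals false = f₀ ∷ f₁ ∷ d₀ ∷ d₁ ∷ f₂ ∷ d₂ ∷ []
  arrivals true  = f₀ ∷ f₁ ∷ d₀ ∷ d₂ ∷ f₂ ∷ d₁ ∷ []

  arrivals≡ : ∀ b k → Instance.arrivals (inOrder (J k) (hardOrder b)) ≡ arrivals b
  arrivals≡ false k = ≡.refl
  arrivals≡ true  k = ≡.refl

  ALG-hard : ∀ alg b k →
    ALG alg (instanceAt (hard b) k) ≡ expectedReward (J k) (alg (J k)) [] (arrivals b)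
  ALG-hard alg b k = ALG-inOrder (J k) alg (hardOrder b)
    {instanceAt (hard b) k} {arrivals b} ≡.refl (arrivals≡ b k)

  -- With probability ε the free vertex comes and pays `k + 1`; otherwise the later deterministic
  -- vertex surely pays 1. In all six cases the filtered list yields the same expression.
  value≈share : ∀ b k i →
    Greedy.value (J k) (target b) (target-adjacent b) (arrivals b) i ≈ share k
  value≈share b k i = trans
    (Greedy.value-filter (J k) (target b) (target-adjacent b) (arrivals b) i)
    (twoVisits b i)
    where
    twoVisits : ∀ b i → Greedy.value (J k) (target b) (target-adjacent b)
      (filter (λ t → target b t ≟ i) (arrivals b)) i ≈ share k
    twoVisits = λ { false 0F → visits ; false 1F → visits ; false 2F → visits
                  ; true  0F → visits ; true  1F → visits ; true  2F → visits }
      where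
      sure : (1# - 1#) * 0# + 1# * 1# ≈ 1#
      sure = trans (+-cong (zeroʳ (1# - 1#)) (*-identityˡ 1#)) (+-identityˡ 1#)

      visits : (1# - ε k) * ((1# - 1#) * 0# + 1# * 1#) + ε k * (1# + fromℕ k) ≈ share k
      visits = begin-equality
        (1# - ε k) * ((1# - 1#) * 0# + 1# * 1#) + ε k * (1# + fromℕ k)
          ≈⟨ +-congʳ (*-congˡ sure) ⟩
        (1# - ε k) * 1# + ε k * (1# + fromℕ k)
          ≈⟨ solve 3 (λ q e m → q :* con 1 :+ e :* (con 1 :+ m) := q :+ e :+ e :* m)
               refl (1# - ε k) (ε k) (fromℕ k) ⟩
        (1# - ε k) + ε k + ε k * fromℕ k
          ≈⟨ +-congʳ (x-y+y≈x 1# (ε k)) ⟩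
        share k ∎

  opt-isOPT : ∀ b k → IsOPTonline (instanceAt (hard b) k) (opt k)
  opt-isOPT b k = Greedy.greedy-isOPTonline (J k) (target b) (target-adjacent b) (hardOrder b)
    {instanceAt (hard b) k} {arrivals b} ≡.refl (arrivals≡ b k)
    (excess-nonneg k) (λ _ t _ → ≤.reflexive (ω≈1+excess k t))
    (sum-cong-≋ (value≈share b k)) (total b)
    where
    -- One unit for each offline vertex and `ε k * fromℕ k` for each free arrival; the deterministic
    -- arrivals have no excess.
    total : ∀ b → fromℕ 3 + foldr (λ t s → ρ k t * excess k t + s) 0# (arrivals b) ≈ opt k
    total = λ { false → six ; true → six }
      where
      six = solve 1 (λ x → let one = con 1; z = con 1 :* con 0; r = one :+ x in
        :fromℕ 3 :+ (x :+ (x :+ (z :+ (z :+ (x :+ (z :+ con 0))))))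
        := r :+ (r :+ (r :+ con 0))) refl (ε k * fromℕ k)

  -- The matching probabilities of the greedy policy for the first order; the LP does not see the
  -- order, so they serve for both. The values `ε k` at non-edges are masked by the sums over edges.
  lpSolution : ℕ → Fin 3 → Fin 6 → Carrier
  lpSolution k i t =
    if isFree t then ε k else (if does (target false t ≟ i) then ε k * fromℕ k else 0#)

  lpSolution-feasible : ∀ b k → LPFeasible (instanceAt (hard b) k) (lpSolution k)
  lpSolution-feasible b k = record
    { nonneg    = λ i t _ → nonneg i t
    ; onlineCap = cap
    ; offline   = row
    }
    where
    m = ε k * fromℕ k

    nonneg : ∀ i t → 0# ≤ lpSolution k i t
    nonneg i t with isFree t | does (target false t ≟ i)
    ... | true  | _     = proj₁ (0<ε k)
    ... | false | true  = 0≤ε*k k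
    ... | false | false = ≤.refl

    cap : ∀ t → Graph.sumAtV hardGraph t (λ i → lpSolution k i t) ≤ ρ k t
    cap f₀ = ≤.reflexive (solve 1 (λ e → e :+ (con 0 :+ (con 0 :+ con 0)) := e) refl (ε k))
    cap f₁ = ≤.reflexive (solve 1 (λ e → con 0 :+ (e :+ (con 0 :+ con 0)) := e) refl (ε k))
    cap f₂ = ≤.reflexive (solve 1 (λ e → con 0 :+ (con 0 :+ (e :+ con 0)) := e) refl (ε k))
    cap d₀ = ≤.trans (≤.reflexive
      (solve 1 (λ e → con 0 :+ (e :+ (con 0 :+ con 0)) := e) refl m)) (ε*k≤1 k)
    cap d₁ = ≤.trans (≤.reflexive
      (solve 1 (λ e → e :+ (con 0 :+ (con 0 :+ con 0)) := e) refl m)) (ε*k≤1 k)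
    cap d₂ = ≤.trans (≤.reflexive
      (solve 1 (λ e → con 0 :+ (con 0 :+ (e :+ con 0)) := e) refl m)) (ε*k≤1 k)

    row : ∀ i → Graph.sumAtU hardGraph i (lpSolution k i) ≤ 1#
    row 0F = ≤.reflexive (trans (solve 2 (λ e m → let z = con 0 in
      e :+ (z :+ (z :+ (m :+ (z :+ (z :+ z))))) := e :+ m) refl (ε k) m) (ε-identity k))
    row 1F = ≤.reflexive (trans (solve 2 (λ e m → let z = con 0 in
      z :+ (e :+ (m :+ (z :+ (z :+ (z :+ z))))) := e :+ m) refl (ε k) m) (ε-identity k))
    row 2F = ≤.reflexive (trans (solve 2 (λ e m → let z = con 0 in
      z :+ (z :+ (z :+ (z :+ (e :+ (m :+ z))))) := e :+ m) refl (ε k) m) (ε-identity k))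

  lpSolution-value : ∀ b k → opt k ≈ LPObjective (instanceAt (hard b) k) (lpSolution k)
  lpSolution-value b k = sym (sum-cong-≋ row)
    where
    m = ε k * fromℕ k

    finish : (1# + fromℕ k) * ε k + 1# * m ≈ share k
    finish = +-cong (*-inverse (0<fromℕ-suc k)) (*-identityˡ m)

    row : ∀ i → Graph.sumAtU hardGraph i (λ t → ω k t * lpSolution k i t) ≈ share k
    row 0F = trans (solve 3 (λ w e m → let z = con 0 in
      w :* e :+ (z :+ (con 1 :* z :+ (con 1 :* m :+ (z :+ (z :+ z)))))
      := w :* e :+ con 1 :* m) refl (fromℕ (suc k)) (ε k) m) finish
    row 1F = trans (solve 3 (λ w e m → let z = con 0 in
      z :+ (w :* e :+ (con 1 :* m :+ (z :+ (z :+ (con 1 :* z :+ z)))))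
      := w :* e :+ con 1 :* m) refl (fromℕ (suc k)) (ε k) m) finish
    row 2F = trans (solve 3 (λ w e m → let z = con 0 in
      z :+ (z :+ (z :+ (con 1 :* z :+ (w :* e :+ (con 1 :* m :+ z)))))
      := w :* e :+ con 1 :* m) refl (fromℕ (suc k)) (ε k) m) finish

  -- Splitting the weight `k + 1` as 1 + k turns the objective of a row into its total mass, at most
  -- 1 by the offline constraint, plus `k` times the mass on the free vertex, at most `ε k` by the
  -- online one.
  LPObjective-≤opt : ∀ b k x → LPFeasible (instanceAt (hard b) k) x →
    LPObjective (instanceAt (hard b) k) x ≤ opt k
  LPObjective-≤opt b k x feasible = sum-mono row
    where
    open LPFeasible feasible

    bound : ∀ {s y z} → s ≤ 1# → y ≤ ε k → z ≈ s + y * fromℕ k → z ≤ share k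
    bound s≤1 y≤ε z≈ = ≤.trans (≤.reflexive z≈) (+-mono-≤ s≤1 (*-monoʳ-≤ (fromℕ k) (0≤fromℕ k) y≤ε))

    row : ∀ i → Graph.sumAtU hardGraph i (λ t → ω k t * x i t) ≤ share k
    row 0F = bound (offline 0F)
      (≤.trans (≤.reflexive (solve 1 (λ e → e := e :+ (con 0 :+ (con 0 :+ con 0))) refl _))
        (onlineCap f₀))
      (solve 4 (λ w e a b → let z = con 0; one = con 1 in
        (one :+ w) :* e :+ (z :+ (one :* a :+ (one :* b :+ (z :+ (z :+ z)))))
        := (e :+ (z :+ (a :+ (b :+ (z :+ (z :+ z)))))) :+ e :* w)
        refl (fromℕ k) (x 0F f₀) (x 0F d₀) (x 0F d₁))
    row 1F = bound (offline 1F)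
      (≤.trans (≤.reflexive (solve 1 (λ e → e := con 0 :+ (e :+ (con 0 :+ con 0))) refl _))
        (onlineCap f₁))
      (solve 4 (λ w e a b → let z = con 0; one = con 1 in
        z :+ ((one :+ w) :* e :+ (one :* a :+ (z :+ (z :+ (one :* b :+ z)))))
        := (z :+ (e :+ (a :+ (z :+ (z :+ (b :+ z)))))) :+ e :* w)
        refl (fromℕ k) (x 1F f₁) (x 1F d₀) (x 1F d₂))
    row 2F = bound (offline 2F)
      (≤.trans (≤.reflexive (solve 1 (λ e → e := con 0 :+ (con 0 :+ (e :+ con 0))) refl _))
        (onlineCap f₂))
      (solve 4 (λ w e a b → let z = con 0; one = con 1 in
        z :+ (z :+ (z :+ (one :* a :+ ((one :+ w) :* e :+ (one :* b :+ z)))))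
        := (z :+ (z :+ (z :+ (a :+ (e :+ (b :+ z)))))) :+ e :* w)
        refl (fromℕ k) (x 2F f₂) (x 2F d₁) (x 2F d₂))

  opt-isLP : ∀ b k → IsLPexAnte (instanceAt (hard b) k) (opt k)
  opt-isLP b k = (_ , lpSolution-feasible b k , lpSolution-value b k) ,
    λ { y (x , feasible , y≈) → ≤.trans (≤.reflexive y≈) (LPObjective-≤opt b k x feasible) }

  opt+3ε≈6 : ∀ k → opt k + fromℕ 3 * ε k ≈ fromℕ 6
  opt+3ε≈6 k = begin-equality
    opt k + fromℕ 3 * ε k
      ≈⟨ solve 2 (λ m e → let r = con 1 :+ m in (r :+ (r :+ (r :+ con 0))) :+ :fromℕ 3 :* e
           := :fromℕ 3 :+ :fromℕ 3 :* (e :+ m)) refl (ε k * fromℕ k) (ε k) ⟩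
    fromℕ 3 + fromℕ 3 * (ε k + ε k * fromℕ k)
      ≈⟨ +-congˡ (*-congˡ (ε-identity k)) ⟩
    fromℕ 3 + fromℕ 3 * 1#
      ≈⟨ solve 0 (:fromℕ 3 :+ :fromℕ 3 :* con 1 := :fromℕ 6) refl ⟩
    fromℕ 6 ∎

  0<opt : ∀ k → 0# < opt k
  0<opt k = <-≤-trans 0<1 (≤.trans (x≤x+y 1# (0≤ε*k k)) (x≤x+y (share k)
    (sum-nonneg {2} λ _ → +-nonneg 0≤1 (0≤ε*k k))))

  perfect : Fin 3 → Maybe (Fin 6)
  perfect 0F = just d₀
  perfect 1F = just d₂
  perfect 2F = just d₁

  perfect-isDMatching : ∀ b → AsymptoticInstance.IsDMatching (hard b) perfect
  perfect-isDMatching b = record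
    { isEdge    = λ { 0F _ ≡.refl → tt ; 1F _ ≡.refl → tt ; 2F _ ≡.refl → tt }
    ; inD       = λ { 0F _ ≡.refl → ≡.refl ; 1F _ ≡.refl → ≡.refl ; 2F _ ≡.refl → ≡.refl }
    ; injective = λ { 0F 0F _ _ _ → ≡.refl ; 1F 1F _ _ _ → ≡.refl ; 2F 2F _ _ _ → ≡.refl
                    ; 0F 1F _ ≡.refl () ; 0F 2F _ ≡.refl () ; 1F 0F _ ≡.refl ()
                    ; 1F 2F _ ≡.refl () ; 2F 0F _ ≡.refl () ; 2F 1F _ ≡.refl () }
    }

  -- Edges to deterministic vertices weigh 1, and `perfect` shows that total weight 3 is reachable;
  -- a maximum matching therefore covers every offline vertex.
  balance : ∀ b k M → AsymptoticInstance.IsMaxWeightDMatching (hard b) k M →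
    ∀ i → AsymptoticInstance.weightAt (hard b) k M i ≈ AsymptoticInstance.vU (hard b) i
  balance b k M (isM , maximal) i = trans
    (sum-saturated weight≤1
      (≤.trans (≤.reflexive perfectWeight) (maximal perfect (perfect-isDMatching b))) i)
    (sym (vU≈1 i))
    where
    open AsymptoticInstance (hard b) using (weightAt; matchingWeight; vU; module IsDMatching)

    perfectWeight : sum {3} (λ _ → 1#) ≈ matchingWeight k perfect
    perfectWeight = refl

    weight≤1 : ∀ i → weightAt k M i ≤ 1#
    weight≤1 i with M i in eq
    ... | nothing = 0≤1
    ... | just t rewrite IsDMatching.inD isM i t eq = ≤.refl

    vU≈1 : ∀ i → vU i ≈ 1#
    vU≈1 0F = solve 0 (let z = con 0 in con 1 :+ (z :+ (z :+ (z :+ (z :+ (z :+ z))))) := con 1) refl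
    vU≈1 1F = solve 0 (let z = con 0 in z :+ (con 1 :+ (z :+ (z :+ (z :+ (z :+ z))))) := con 1) refl
    vU≈1 2F = solve 0 (let z = con 0 in z :+ (z :+ (z :+ (z :+ (con 1 :+ (z :+ z))))) := con 1) refl

  module _ (em : ExcludedMiddle 0ℓ) where

    opt-limit : opt ⟶ fromℕ 6
    opt-limit δ 0<δ with reciprocal-small em (fromℕ 3) 0<δ
    ... | N , small = N , λ k N≤k → below k (small k N≤k) , ≤-<-trans (opt≤6 k) 6<6+δ
      where
      opt≤6 : ∀ k → opt k ≤ fromℕ 6
      opt≤6 k = ≤.trans (x≤x+y (opt k) (*-nonneg (0≤fromℕ 3) (proj₁ (0<ε k))))
        (≤.reflexive (opt+3ε≈6 k))

      6<6+δ : fromℕ 6 < fromℕ 6 + δ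
      6<6+δ = ≰⇒> λ le → <⇒≱ 0<δ (linear le
        (solve 2 (λ s d → d :+ s := con 0 :+ (s :+ d)) refl (fromℕ 6) δ))

      below : ∀ k → fromℕ 3 * ε k < δ → fromℕ 6 - δ < opt k
      below k 3ε<δ = ≰⇒> λ opt≤6-δ → <⇒≱ 3ε<δ (+-cancelˡ-≤ (opt k) (begin
        opt k + δ               ≤⟨ +-monoˡ-≤ δ opt≤6-δ ⟩
        (fromℕ 6 - δ) + δ       ≈⟨ x-y+y≈x (fromℕ 6) δ ⟩
        fromℕ 6                 ≈⟨ opt+3ε≈6 k ⟨
        opt k + fromℕ 3 * ε k   ∎))

    ε-limit : ε ⟶ 0#
    ε-limit δ 0<δ with reciprocal-small em 1# 0<δ
    ... | N , small = N , λ k N≤k → <-≤-trans -δ<0 (proj₁ (0<ε k)) ,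
        ≤-<-trans (≤.reflexive (sym (*-identityˡ (ε k))))
          (<-≤-trans (small k N≤k) (≤.reflexive (sym (+-identityˡ δ))))
      where
      -δ<0 : 0# - δ < 0#
      -δ<0 = ≰⇒> λ le → <⇒≱ 0<δ (≤.trans (≤.reflexive (sym (+-identityˡ δ)))
        (≤.trans (+-monoˡ-≤ δ le) (≤.reflexive (x-y+y≈x 0# δ))))

    hard∈𝒞 : ∀ b → InClass𝒞 (hard b)
    hard∈𝒞 b = record
      { det-prob         = λ t t∈D k → ≈-reflexive (≡.cong (λ f → if f then ε k else 1#) t∈D)
      ; free-prob        = λ { f₀ _ → 0<ε ; f₁ _ → 0<ε ; f₂ _ → 0<ε }
      ; free-limit       = λ { f₀ _ → ε-limit ; f₁ _ → ε-limit ; f₂ _ → ε-limit }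
      ; onlineWeight     = ω , (λ _ _ _ _ → refl) , ω*ρ≈1
      ; has-neighbour    = λ t → target b t , target-adjacent b t
      -- The two optima are the same number at every index, so a single limit computation serves
      -- both.
      ; opt-lp           = opt , opt , fromℕ 6 , opt-isOPT b , opt-isLP b , opt-limit , opt-limit
      ; balanced         = balance b
      ; unique-neighbour = λ
          { f₀ _ → 0F , tt , λ { 0F _ → ≡.refl ; 1F () ; 2F () }
          ; f₁ _ → 1F , tt , λ { 0F () ; 1F _ → ≡.refl ; 2F () }
          ; f₂ _ → 2F , tt , λ { 0F () ; 1F () ; 2F _ → ≡.refl } }
      }

-- One policy run in both orders

module OrderUnaware (ℝ : CompleteOrderedField) (k : ℕ)
  (π : OnlineMatching.Policy ℝ (HardInstance.J ℝ k)) where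

  open CompleteOrderedField ℝ hiding (zero)
  open OrderedField ℝ
  open ≤-Reasoning
  open OnlineMatching ℝ
  open HardInstance ℝ
  open Policies ℝ (J k)
  open Solver commutativeSemiring using (solve; con; _:=_; _:+_; _:*_)

  E : History (J k) → List (Fin 6) → Carrier
  E = expectedReward (J k) π

  W : Carrier
  W = fromℕ (suc k)

  last-≤ : ∀ t → ω k t ≤ 1# → ∀ h → E h (t ∷ []) ≤ 1#
  last-≤ t ω≤1 h = begin
    E h (t ∷ [])        ≤⟨ mix-≤ π h t 0≤1 ≤.refl ≤.refl (λ _ _ _ → matched) ⟩
    0# + ρ k t * 1#     ≈⟨ solve 1 (λ x → con 0 :+ x :* con 1 := x) refl (ρ k t) ⟩
    ρ k t               ≤⟨ ρ≤1 k t ⟩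
    1#                  ∎
    where
    matched : ω k t + 0# ≤ 0# + 1#
    matched = ≤.trans (≤.reflexive (+-comm (ω k t) 0#)) (+-monoʳ-≤ 0# ω≤1)

  -- The only neighbour of `f₂` is 2, and its expected gain is ε (k + 1) = 1 if 2 is vacant. Putting
  -- the vacancy into the surplus of `mix-≤` makes that gain vanish otherwise.
  lastTwo-≤ : ∀ t → (∀ h → E h (t ∷ []) ≤ 1#) → ∀ h → E h (f₂ ∷ t ∷ []) ≤ 1# + vacancy h 2F
  lastTwo-≤ t last h = begin
    E h (f₂ ∷ t ∷ [])
      ≤⟨ mix-≤ π h f₂ (*-nonneg (vacancy-nonneg h 2F) (0≤fromℕ (suc k)))
           (last _) (last _) matched ⟩
    1# + ε k * (vacancy h 2F * W)
      ≈⟨ +-congˡ (solve 3 (λ e v w → e :* (v :* w) := v :* (e :* w)) refl (ε k) (vacancy h 2F) W) ⟩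
    1# + vacancy h 2F * (ε k * W)
      ≈⟨ +-congˡ (trans (*-congˡ (ε-inverse k)) (*-identityʳ (vacancy h 2F))) ⟩
    1# + vacancy h 2F                   ∎
    where
    matched : ∀ i → T (adjacent i f₂) → ¬ Matched (J k) h i →
      W + E (realised f₂ (just i) ∷ h) (t ∷ []) ≤ 1# + vacancy h 2F * W
    matched 2F _ ¬m = begin
      W + E (realised f₂ (just 2F) ∷ h) (t ∷ [])    ≤⟨ +-monoʳ-≤ W (last _) ⟩
      W + 1#                                        ≈⟨ +-comm W 1# ⟩
      1# + W                                        ≈⟨ +-congˡ (*-identityˡ W) ⟨
      1# + 1# * W
        ≈⟨ +-congˡ (*-congʳ (vacancy-unmatched h 2F ¬m)) ⟨
      1# + vacancy h 2F * W                         ∎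

  -- If the early neighbour i₀ of t is taken, matching t to 2F forfeits f₂.
  lastThree-≤ : ∀ t t′ i₀ → (∀ i → T (adjacent i t) → i ≡ i₀ ⊎ i ≡ 2F) → ω k t ≤ 1# →
    (∀ h → E h (t′ ∷ []) ≤ 1#) → ∀ h → E h (t ∷ f₂ ∷ t′ ∷ []) ≤ fromℕ 2 + vacancy h i₀
  lastThree-≤ t t′ i₀ neighbours ω≤1 last h = begin
    E h (t ∷ f₂ ∷ t′ ∷ [])              ≤⟨ mix-≤ π h t ≤.refl unmatched unmatched matched ⟩
    c + ρ k t * 0#                      ≈⟨ trans (+-congˡ (zeroʳ (ρ k t))) (+-identityʳ c) ⟩
    c                                   ∎
    where
    c : Carrier
    c = fromℕ 2 + vacancy h i₀

    two : 1# + 1# ≈ fromℕ 2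
    two = +-congˡ (sym (+-identityʳ 1#))

    unmatched : ∀ {h′} → E h′ (f₂ ∷ t′ ∷ []) ≤ c
    unmatched {h′} = begin
      E h′ (f₂ ∷ t′ ∷ [])         ≤⟨ lastTwo-≤ t′ last h′ ⟩
      1# + vacancy h′ 2F          ≤⟨ +-monoʳ-≤ 1# (vacancy≤1 h′ 2F) ⟩
      1# + 1#                     ≈⟨ two ⟩
      fromℕ 2                     ≤⟨ x≤x+y (fromℕ 2) (vacancy-nonneg h i₀) ⟩
      c                           ∎

    matched : ∀ i → T (adjacent i t) → ¬ Matched (J k) h i →
      ω k t + E (realised t (just i) ∷ h) (f₂ ∷ t′ ∷ []) ≤ c + 0#
    matched i e ¬m with neighbours i e
    ... | inj₁ ≡.refl = begin
      ω k t + E h′ (f₂ ∷ t′ ∷ [])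
        ≤⟨ +-mono-≤ ω≤1 (≤.trans (lastTwo-≤ t′ last h′) (+-monoʳ-≤ 1# (vacancy≤1 h′ 2F))) ⟩
      1# + (1# + 1#)
        ≈⟨ solve 0 (con 1 :+ (con 1 :+ con 1) := :fromℕ 2 :+ con 1 :+ con 0) refl ⟩
      fromℕ 2 + 1# + 0#                   ≈⟨ +-congʳ (+-congˡ (vacancy-unmatched h i₀ ¬m)) ⟨
      c + 0#                              ∎
      where h′ = realised t (just i₀) ∷ h
    ... | inj₂ ≡.refl = begin
      ω k t + E h′ (f₂ ∷ t′ ∷ [])         ≤⟨ +-mono-≤ ω≤1 (lastTwo-≤ t′ last h′) ⟩
      1# + (1# + 0#)                      ≤⟨ x≤x+y (fromℕ 2) (vacancy-nonneg h i₀) ⟩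
      c                                   ≈⟨ +-identityʳ c ⟨
      c + 0#                              ∎
      where h′ = realised t (just 2F) ∷ h

  tail₁ tail₂ : List (Fin 6)
  tail₁ = d₁ ∷ f₂ ∷ d₂ ∷ []
  tail₂ = d₂ ∷ f₂ ∷ d₁ ∷ []

  tail₁-≤ : ∀ h → E h tail₁ ≤ fromℕ 2 + vacancy h 0F
  tail₁-≤ = lastThree-≤ d₁ d₂ 0F
    (λ { 0F _ → inj₁ ≡.refl ; 1F () ; 2F _ → inj₂ ≡.refl }) ≤.refl (last-≤ d₂ ≤.refl)

  tail₂-≤ : ∀ h → E h tail₂ ≤ fromℕ 2 + vacancy h 1F
  tail₂-≤ = lastThree-≤ d₂ d₁ 1F
    (λ { 0F () ; 1F _ → inj₁ ≡.refl ; 2F _ → inj₂ ≡.refl }) ≤.refl (last-≤ d₁ ≤.refl)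

  -- The first tail earns its third unit from a vacant 0, the second from a vacant 1. Matching `d₀`
  -- brings one unit per order but destroys one of these: 2 + 2 + 3. Leaving it unmatched gives at
  -- most 3 + 3.
  joint-d₀-≤ : ∀ h → E h (d₀ ∷ tail₁) + E h (d₀ ∷ tail₂) ≤ fromℕ 7
  joint-d₀-≤ h = begin
    E h (d₀ ∷ tail₁) + E h (d₀ ∷ tail₂)
      ≤⟨ joint-≤ π h d₀ {tail₁} {tail₂} ≤.refl (λ {h′} → unmatched {h′}) matched ⟩
    fromℕ 7 + 1# * 0#                     ≈⟨ solve 0 (:fromℕ 7 :+ con 1 :* con 0 := :fromℕ 7) refl ⟩
    fromℕ 7                               ∎
    where
    bound : ∀ {h′ x y} → vacancy h′ 0F ≤ x → vacancy h′ 1F ≤ y →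
      E h′ tail₁ + E h′ tail₂ ≤ (fromℕ 2 + x) + (fromℕ 2 + y)
    bound {h′} v₀≤x v₁≤y = +-mono-≤
      (≤.trans (tail₁-≤ h′) (+-monoʳ-≤ (fromℕ 2) v₀≤x))
      (≤.trans (tail₂-≤ h′) (+-monoʳ-≤ (fromℕ 2) v₁≤y))

    unmatched : ∀ {h′} → E h′ tail₁ + E h′ tail₂ ≤ fromℕ 7
    unmatched {h′} = begin
      E h′ tail₁ + E h′ tail₂             ≤⟨ bound {h′} (vacancy≤1 h′ 0F) (vacancy≤1 h′ 1F) ⟩
      (fromℕ 2 + 1#) + (fromℕ 2 + 1#)     ≤⟨ x≤x+y _ 0≤1 ⟩
      (fromℕ 2 + 1#) + (fromℕ 2 + 1#) + 1#
        ≈⟨ solve 0 ((:fromℕ 2 :+ con 1) :+ (:fromℕ 2 :+ con 1) :+ con 1 := :fromℕ 7) refl ⟩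
      fromℕ 7                             ∎

    matched : ∀ i → T (adjacent i d₀) → ¬ Matched (J k) h i →
      (1# + E (realised d₀ (just i) ∷ h) tail₁) + (1# + E (realised d₀ (just i) ∷ h) tail₂)
        ≤ fromℕ 7 + 0#
    matched 0F _ _ = begin
      (1# + E h′ tail₁) + (1# + E h′ tail₂)
        ≈⟨ solve 2 (λ x y → (con 1 :+ x) :+ (con 1 :+ y) := con 1 :+ con 1 :+ (x :+ y))
             refl (E h′ tail₁) (E h′ tail₂) ⟩
      1# + 1# + (E h′ tail₁ + E h′ tail₂)
        ≤⟨ +-monoʳ-≤ _ (bound {h′} ≤.refl (vacancy≤1 h′ 1F)) ⟩
      1# + 1# + ((fromℕ 2 + 0#) + (fromℕ 2 + 1#))
        ≈⟨ solve 0 (con 1 :+ con 1 :+ ((:fromℕ 2 :+ con 0) :+ (:fromℕ 2 :+ con 1)) :=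
             :fromℕ 7 :+ con 0) refl ⟩
      fromℕ 7 + 0# ∎
      where h′ = realised d₀ (just 0F) ∷ h
    matched 1F _ _ = begin
      (1# + E h′ tail₁) + (1# + E h′ tail₂)
        ≈⟨ solve 2 (λ x y → (con 1 :+ x) :+ (con 1 :+ y) := con 1 :+ con 1 :+ (x :+ y))
             refl (E h′ tail₁) (E h′ tail₂) ⟩
      1# + 1# + (E h′ tail₁ + E h′ tail₂)
        ≤⟨ +-monoʳ-≤ _ (bound {h′} (vacancy≤1 h′ 0F) ≤.refl) ⟩
      1# + 1# + ((fromℕ 2 + 1#) + (fromℕ 2 + 0#))
        ≈⟨ solve 0 (con 1 :+ con 1 :+ ((:fromℕ 2 :+ con 1) :+ (:fromℕ 2 :+ con 0)) :=
             :fromℕ 7 :+ con 0) refl ⟩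
      fromℕ 7 + 0# ∎
      where h′ = realised d₀ (just 1F) ∷ h
    matched 2F ()

  -- The bound `c` on the rest holds for every history, so a match costs nothing here and adds at
  -- most an expected unit in each order.
  joint-free-≤ : ∀ t {ts ts′ c} → ρ k t * W ≈ 1# → ω k t ≤ W →
    (∀ h → E h ts + E h ts′ ≤ c) → ∀ h → E h (t ∷ ts) + E h (t ∷ ts′) ≤ c + (1# + 1#)
  joint-free-≤ t {ts} {ts′} {c} ρW≈1 ω≤W rest h = begin
    E h (t ∷ ts) + E h (t ∷ ts′)
      ≤⟨ joint-≤ π h t {ts} {ts′} (+-nonneg 0≤W 0≤W) (rest _) (λ i _ _ → matched i) ⟩
    c + ρ k t * (W + W)             ≈⟨ +-congˡ (trans (distribˡ (ρ k t) W W) (+-cong ρW≈1 ρW≈1)) ⟩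
    c + (1# + 1#)                   ∎
    where
    0≤W = 0≤fromℕ (suc k)

    matched : ∀ i → let h′ = realised t (just i) ∷ h in
      (ω k t + E h′ ts) + (ω k t + E h′ ts′) ≤ c + (W + W)
    matched i = begin
      (ω k t + E h′ ts) + (ω k t + E h′ ts′)
        ≈⟨ solve 3 (λ w x y → (w :+ x) :+ (w :+ y) := (x :+ y) :+ (w :+ w))
             refl (ω k t) (E h′ ts) (E h′ ts′) ⟩
      (E h′ ts + E h′ ts′) + (ω k t + ω k t)  ≤⟨ +-mono-≤ (rest h′) (+-mono-≤ ω≤W ω≤W) ⟩
      c + (W + W)                             ∎
      where h′ = realised t (just i) ∷ h

  joint-≤11 : E [] (arrivals false) + E [] (arrivals true) ≤ fromℕ 11
  joint-≤11 = begin
    E [] (f₀ ∷ f₁ ∷ d₀ ∷ tail₁) + E [] (f₀ ∷ f₁ ∷ d₀ ∷ tail₂)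
      ≤⟨ joint-free-≤ f₀ {f₁ ∷ d₀ ∷ tail₁} {f₁ ∷ d₀ ∷ tail₂} (ε-inverse k) ≤.refl
           (joint-free-≤ f₁ {d₀ ∷ tail₁} {d₀ ∷ tail₂} (ε-inverse k) ≤.refl joint-d₀-≤) [] ⟩
    fromℕ 7 + (1# + 1#) + (1# + 1#)
      ≈⟨ solve 0 (:fromℕ 7 :+ (con 1 :+ con 1) :+ (con 1 :+ con 1) := :fromℕ 11) refl ⟩
    fromℕ 11 ∎

-- From the joint bound to the competitive ratio

module Main (ℝ : CompleteOrderedField) where

  open CompleteOrderedField ℝ hiding (zero)
  open OrderedField ℝ
  open ≤-Reasoning
  open OnlineMatching ℝ
  open HardInstance ℝ
  open AsymptoticInstance using (instanceAt)
  open Solver commutativeSemiring using (solve; con; _:=_; _:+_; _:*_)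

  ratio : Carrier
  ratio = fromℕ 11 / fromℕ 12

  12⁻¹-inverse : fromℕ 12 * fromℕ 12 ⁻¹ ≈ 1#
  12⁻¹-inverse = *-inverse (0<fromℕ-suc 11)

  ratio*12≈11 : ratio * fromℕ 12 ≈ fromℕ 11
  ratio*12≈11 = trans (solve 3 (λ a b c → a :* b :* c := a :* (c :* b)) refl
      (fromℕ 11) (fromℕ 12 ⁻¹) (fromℕ 12))
    (trans (*-congˡ 12⁻¹-inverse) (*-identityʳ (fromℕ 11)))

  ratio≤1 : ratio ≤ 1#
  ratio≤1 = begin
    ratio                     ≤⟨ x≤x+y ratio (proj₁ (0<x⇒0<x⁻¹ (0<fromℕ-suc 11))) ⟩
    ratio + fromℕ 12 ⁻¹
      ≈⟨ solve 1 (λ y → :fromℕ 11 :* y :+ y := :fromℕ 12 :* y) refl (fromℕ 12 ⁻¹) ⟩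
    fromℕ 12 * fromℕ 12 ⁻¹    ≈⟨ 12⁻¹-inverse ⟩
    1#                        ∎

  11≤2opt : ∀ k → fromℕ 11 ≤ (ratio + ε k) * opt k + (ratio + ε k) * opt k
  -- With r = `ratio`, twice (r + ε)(6 - 3ε) equals 11 + 6ε(2 - r - ε), and the last factor is
  -- nonnegative because r and ε are at most 1.
  11≤2opt k = linear
    (*-monoˡ-≤ (fromℕ 6 * e) (*-nonneg (0≤fromℕ 6) (proj₁ (0<ε k)))
      (+-mono-≤ ratio≤1 (ε≤1 k)))
    (begin-equality
      fromℕ 11 + fromℕ 6 * e * (1# + 1#)
        ≈⟨ +-congʳ ratio*12≈11 ⟨
      ratio * fromℕ 12 + fromℕ 6 * e * (1# + 1#)
        ≈⟨ solve 2 (λ r e → r :* :fromℕ 12 :+ :fromℕ 6 :* e :* (con 1 :+ con 1)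
             := (r :+ e) :* :fromℕ 6 :+ (r :+ e) :* :fromℕ 6) refl ratio e ⟩
      b * fromℕ 6 + b * fromℕ 6
        ≈⟨ +-cong (*-congˡ (opt+3ε≈6 k)) (*-congˡ (opt+3ε≈6 k)) ⟨
      b * (opt k + fromℕ 3 * e) + b * (opt k + fromℕ 3 * e)
        ≈⟨ solve 3 (λ b o e → b :* (o :+ :fromℕ 3 :* e) :+ b :* (o :+ :fromℕ 3 :* e)
             := b :* o :+ b :* o :+ :fromℕ 6 :* e :* b) refl b (opt k) e ⟩
      b * opt k + b * opt k + fromℕ 6 * e * b ∎)
    where
    e b : Carrier
    e = ε k
    b = ratio + e

  smaller-ratio : ∀ k {x y} → x + y ≤ fromℕ 11 → x / opt k ≤ ratio + ε k ⊎ y / opt k ≤ ratio + ε k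
  smaller-ratio k {x} {y} x+y≤11 with ≤.total x y
  ... | inj₁ x≤y = inj₁ (x≤y*z⇒x/z≤y (0<opt k)
        (halve-≤ (≤.trans (+-monoʳ-≤ x x≤y) (≤.trans x+y≤11 (11≤2opt k)))))
  ... | inj₂ y≤x = inj₂ (x≤y*z⇒x/z≤y (0<opt k)
        (halve-≤ (≤.trans (+-monoˡ-≤ y y≤x) (≤.trans x+y≤11 (11≤2opt k)))))

  ε-antitone : ∀ {m n} → m ℕ.≤ n → ε n ≤ ε m
  ε-antitone {m} {n} m≤n = begin
    ε n                           ≈⟨ *-identityʳ (ε n) ⟨
    ε n * 1#                      ≈⟨ *-congˡ (*-inverse (0<fromℕ-suc m)) ⟨
    ε n * (fromℕ (suc m) * ε m)   ≤⟨ *-monoˡ-≤ (ε n) (proj₁ (0<ε n))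
                                       (*-monoʳ-≤ (ε m) (proj₁ (0<ε m))
                                         (fromℕ-mono-≤ (ℕ.s≤s m≤n))) ⟩
    ε n * (fromℕ (suc n) * ε m)   ≈⟨ *-assoc (ε n) (fromℕ (suc n)) (ε m) ⟨
    ε n * fromℕ (suc n) * ε m     ≈⟨ *-congʳ (ε-inverse n) ⟩
    1# * ε m                      ≈⟨ *-identityˡ (ε m) ⟩
    ε m                           ∎

  -- For each `k` the two orders share the unordered instance `J k`, so the algorithm runs the same
  -- policy `alg (J k)` in both and the joint bound applies.
  bad-order : ExcludedMiddle 0ℓ → ∀ alg →
    ∃[ b ] ∀ n → ∃[ k ] (n ℕ.≤ k × ALG alg (instanceAt (hard b) k) / opt k ≤ ratio + ε k)
  bad-order em alg = [ (λ often → false , often) , (λ often → true , often) ]′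
    (infinitely-often em λ k → smaller-ratio k (≡.subst (_≤ fromℕ 11)
      (≡.sym (≡.cong₂ _+_ (ALG-hard alg false k) (ALG-hard alg true k)))
      (OrderUnaware.joint-≤11 ℝ k (alg (J k)))))

mainTheorem2 :
    ExcludedMiddle 0ℓ →
    (ℝ : CompleteOrderedField) →
    let open CompleteOrderedField ℝ
        open OnlineMatching ℝ
        open AsymptoticInstance using (instanceAt) in
    ∀ (alg : OrderUnawareAlgorithm) (c : Carrier) →
    fromℕ 11 / fromℕ 12 < c →
    ∃[ A ] (InClass𝒞 A ×
      ∃ λ (opt : ℕ → Carrier) →
        ((∀ k → IsOPTonline (instanceAt A k) (opt k)) ×
         (∀ k → 0# < opt k) ×
         ∃[ l ] (IsLiminf (λ k → ALG alg (instanceAt A k) / opt k) l × l < c)))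
mainTheorem2 em ℝ alg c ratio<c =
  let b , often = bad-order em alg
      l , isLiminf , l<c = liminf<c b often
  in hard b , hard∈𝒞 em b , opt , opt-isOPT b , 0<opt , l , isLiminf , l<c
  where
  open CompleteOrderedField ℝ hiding (zero)
  open OrderedField ℝ
  open ≤-Reasoning
  open OnlineMatching ℝ
  open AsymptoticInstance using (instanceAt)
  open HardInstance ℝ
  open Main ℝ

  0<c-ratio : 0# < c - ratio
  0<c-ratio = ≰⇒> λ le → <⇒≱ ratio<c (≤.trans (≤.reflexive (sym (x-y+y≈x c ratio)))
    (≤.trans (+-monoˡ-≤ ratio le) (≤.reflexive (+-identityˡ ratio))))

  small : ∃[ N ] ∀ k → N ℕ.≤ k → 1# * ε k < c - ratio
  small = reciprocal-small em 1# 0<c-ratio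

  N : ℕ
  N = proj₁ small

  ratio+ε<c : ratio + ε N < c
  ratio+ε<c = ≰⇒> λ c≤ → <⇒≱ (proj₂ small N ℕₚ.≤-refl) (+-cancelʳ-≤ ratio (begin
    (c - ratio) + ratio   ≈⟨ x-y+y≈x c ratio ⟩
    c                     ≤⟨ c≤ ⟩
    ratio + ε N           ≈⟨ +-comm ratio (ε N) ⟩
    ε N + ratio           ≈⟨ +-congʳ (*-identityˡ (ε N)) ⟨
    1# * ε N + ratio      ∎))

  liminf<c : ∀ b →
    (∀ n → ∃[ k ] (n ℕ.≤ k × ALG alg (instanceAt (hard b) k) / opt k ≤ ratio + ε k)) →
    ∃[ l ] (IsLiminf (λ k → ALG alg (instanceAt (hard b) k) / opt k) l × l < c)
  liminf<c b often =
    let l , isLiminf , l≤ = liminf-bound a 0≤a below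
    in l , isLiminf , ≤-<-trans l≤ ratio+ε<c
    where
    a : ℕ → Carrier
    a k = ALG alg (instanceAt (hard b) k) / opt k

    0≤a : ∀ k → 0# ≤ a k
    0≤a k = *-nonneg (≡.subst (0# ≤_) (≡.sym (ALG-hard alg b k))
        (Policies.expectedReward-nonneg ℝ (J k) (alg (J k)) [] (arrivals b)))
      (proj₁ (0<x⇒0<x⁻¹ (0<opt k)))

    -- Searching beyond `n ⊔ N` replaces the varying error `ε k` by the fixed `ε N`, so that a
    -- single bound strictly below `c` recurs.
    below : ∀ n → ∃[ k ] (n ℕ.≤ k × a k ≤ ratio + ε N)
    below n = let k , n⊔N≤k , a≤ = often (n ⊔ N) in
      k , ℕₚ.≤-trans (ℕₚ.m≤m⊔n n N) n⊔N≤k ,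
      ≤.trans a≤ (+-monoʳ-≤ ratio (ε-antitone (ℕₚ.≤-trans (ℕₚ.m≤n⊔m n N) n⊔N≤k)))
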